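{- Every $(K_3, K_4)$-co-critical graph on $n\ge 9$ vertices has minimum degree at least seven. Moreover, the bound is sharp: for every $n\ge 9$ there exists a $(K_3,K_4)$-co-critical graph on $n$ vertices with minimum degree exactly seven.
   Context: All graphs are finite, simple and undirected. For graphs $G, H_1, H_2$, write $G\rightarrow (H_1,H_2)$ if every 2-coloring of the edges of $G$ with colors red and blue contains a red copy of $H_1$ or a blue copy of $H_2$ (as subgraphs). A non-complete graph $G$ is $(H_1,H_2)$-co-critical if $G\not\rightarrow(H_1,H_2)$ but $G+e\rightarrow(H_1,H_2)$ for every edge $e$ of the complement $\overline{G}$, where $G+e$ is the graph obtained from $G$ by adding $e$. -}

module Defs where

open import Data.Nat using (ℕ; _≤_; _+_)
open import Data.Bool using (Bool; true; false; _∨_; _∧_; if_then_else_)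
open import Data.Fin using (Fin; _≟_)
open import Data.List using (List; map; allFin)
open import Data.Nat.ListAction using (sum)
open import Data.Product using (Σ; _×_; ∃; _,_)
open import Data.Sum using (_⊎_)
open import Relation.Nullary using (¬_; does)
open import Relation.Binary.PropositionalEquality using (_≡_; _≢_)

record Graph (n : ℕ) : Set where
  field
    adj    : Fin n → Fin n → Bool
    sym    : ∀ x y → adj x y ≡ adj y x
    irrefl : ∀ x → adj x x ≡ false
open Graph public

-- A 2-colouring of the edges: a symmetric map on pairs of vertices
-- (true = red, false = blue); only its values on edges matter.
Red Blue : Bool
Red = true
Blue = false

Adjacency : ℕ → Set
Adjacency n = Fin n → Fin n → Bool

MonoK3 : ∀ {n} → Adjacency n → (Fin n → Fin n → Bool) → Bool → Set
MonoK3 {n} a c col =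
  Σ (Fin n) λ x → Σ (Fin n) λ y → Σ (Fin n) λ z →
    (x ≢ y × x ≢ z × y ≢ z) ×
    (a x y ≡ true × a x z ≡ true × a y z ≡ true) ×
    (c x y ≡ col × c x z ≡ col × c y z ≡ col)

MonoK4 : ∀ {n} → Adjacency n → (Fin n → Fin n → Bool) → Bool → Set
MonoK4 {n} a c col =
  Σ (Fin n) λ w → Σ (Fin n) λ x → Σ (Fin n) λ y → Σ (Fin n) λ z →
    (w ≢ x × w ≢ y × w ≢ z × x ≢ y × x ≢ z × y ≢ z) ×
    (a w x ≡ true × a w y ≡ true × a w z ≡ true ×
     a x y ≡ true × a x z ≡ true × a y z ≡ true) ×
    (c w x ≡ col × c w y ≡ col × c w z ≡ col ×
     c x y ≡ col × c x z ≡ col × c y z ≡ col)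

ArrowsK3K4 : ∀ {n} → Adjacency n → Set
ArrowsK3K4 {n} a =
  (c : Fin n → Fin n → Bool) → (∀ x y → c x y ≡ c y x) →
  MonoK3 a c Red ⊎ MonoK4 a c Blue

addEdge : ∀ {n} → Adjacency n → Fin n → Fin n → Adjacency n
addEdge a u v x y =
  a x y ∨ ((does (x ≟ u) ∧ does (y ≟ v)) ∨ (does (x ≟ v) ∧ does (y ≟ u)))

NonComplete : ∀ {n} → Graph n → Set
NonComplete {n} G = Σ (Fin n) λ u → Σ (Fin n) λ v → u ≢ v × adj G u v ≡ false

CoCriticalK3K4 : ∀ {n} → Graph n → Set
CoCriticalK3K4 {n} G =
  NonComplete G ×
  ¬ ArrowsK3K4 (adj G) ×
  (∀ u v → u ≢ v → adj G u v ≡ false → ArrowsK3K4 (addEdge (adj G) u v))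

degree : ∀ {n} → Graph n → Fin n → ℕ
degree {n} G v = sum (map (λ w → if adj G v w then 1 else 0) (allFin n))

MinDegree≥ : ∀ {n} → Graph n → ℕ → Set
MinDegree≥ G k = ∀ v → k ≤ degree G v

MinDegree≡ : ∀ {n} → Graph n → ℕ → Set
MinDegree≡ {n} G k = MinDegree≥ G k × Σ (Fin n) λ v → degree G v ≡ k

{-# OPTIONS --safe #-}

-- Lower bound.  Let v have degree at most 6, let H = G − v carry a colouring without red K₃ and
-- blue K₄, and let N be the neighbourhood of v.  Since no G + uv can be coloured, every non-neighbour
-- u of v is, for every partition N = A ∪ B with A free of red edges and B free of blue triangles,
-- joined in red to A and in blue to both ends of a blue edge of B.  Two non-neighbours that are red
-- to the same a and blue to both ends of the same blue edge are not adjacent, so a partition with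
-- few pairs (a, edge) splits the non-neighbours into few independent sets, and moving vertices
-- between A and B yields either a better partition or structure in N.  In each case the
-- non-neighbours need at most two colours beyond the six used on N, after some of them reuse the
-- colour of a vertex of N they miss, or of two merged non-adjacent ones.  So H is 8-colourable;
-- v sees at most seven of these colours in G + uv, and an 8-colourable graph inherits the colouring
-- of K₈ that witnesses R(3,4) > 8: a contradiction.
--
-- Sharpness.  The join of K₇ with n − 7 isolated vertices is 8-colourable, and each added edge
-- completes a K₉, while R(3,4) ≤ 9.
module Submission where

open import Defs hiding (sym)
open import Data.Bool using (Bool; true; false; if_then_else_; _∨_; _∧_; not)
import Data.Bool as Bool
open import Data.Bool.Properties using (∨-zeroʳ; ∨-comm; ∧-identityʳ; ∧-zeroʳ; ¬-not)
open import Data.Empty using (⊥; ⊥-elim)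
open import Data.Fin using (Fin; zero; suc; toℕ; _≟_; _↑ʳ_)
open import Data.Fin.Patterns
open import Data.Fin.Properties using (any?; injective⇒≤; suc-injective)
open import Data.List
  using (List; []; _∷_; take; drop; length; _++_; filter; map; allFin; replicate; tabulate)
import Data.List as List
open import Data.List.Membership.Propositional using (_∈_; _∉_)
import Data.List.Membership.DecPropositional as DecMembership
open import Data.List.Membership.Propositional.Properties
  using (∈-++⁺ˡ; ∈-++⁺ʳ; ∈-++⁻; ∈-map⁺; ∈-filter⁺; ∈-filter⁻; ∈-allFin)
open import Data.List.Properties
  using (drop-[]; filter-none; length-++; length-map; length-replicate; take++drop≡id)
open import Data.List.Relation.Binary.Permutation.Propositional
  using (_↭_; prep; swap; ↭-refl; ↭-sym; ↭-trans)
open import Data.List.Relation.Binary.Permutation.Propositional.Properties using (∈-resp-↭)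
open import Data.List.Relation.Unary.All using (All; []; _∷_)
import Data.List.Relation.Unary.All as All
import Data.List.Relation.Unary.All.Properties as All
open import Data.List.Relation.Unary.AllPairs using (AllPairs; []; _∷_)
import Data.List.Relation.Unary.AllPairs as AllPairs
import Data.List.Relation.Unary.AllPairs.Properties as AllPairs
open import Data.List.Relation.Unary.Any using (Any; here; there; index)
import Data.List.Relation.Unary.Any as Any
import Data.List.Relation.Unary.Any.Properties as Any
open import Data.List.Relation.Unary.Unique.Propositional using (Unique)
open import Data.Nat using (ℕ; zero; suc; ∣_-_∣; _≤_; _+_; _*_; _∸_; _<_; z≤n; s≤s)
import Data.Nat as ℕ
open import Data.Nat.Divisibility using (_∣_; divides; _∣?_)
open import Data.Nat.ListAction using (sum)
import Data.Nat.Properties as ℕ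
open import Data.Product using (Σ; ∃; ∃₂; _×_; _,_; proj₁; proj₂; map₂)
open import Data.Sum using (_⊎_; inj₁; inj₂)
import Data.Sum as Sum
open import Data.Vec using (Vec; []; _∷_; lookup)
open import Function using (_∘_; case_of_)
open import Relation.Binary.PropositionalEquality
  using (_≡_; _≢_; refl; sym; trans; cong; cong₂; subst)
open import Relation.Nullary using (¬_; Dec; yes; no; does; ¬?; _×-dec_; _⊎-dec_)
open import Relation.Nullary.Decidable
  using (dec-true; dec-false; decidable-stable; toWitness; toWitnessFalse)

-- Reordering lists

toFront : ∀ {A : Set} → ℕ → List A → List A
toFront zero    xs       = xs
toFront (suc i) []       = []
toFront (suc i) (x ∷ xs) with toFront i xs
... | []     = x ∷ []
... | y ∷ ys = y ∷ x ∷ ys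

toFront-↭ : ∀ {A : Set} i (xs : List A) → toFront i xs ↭ xs
toFront-↭ zero    xs       = ↭-refl
toFront-↭ (suc i) []       = ↭-refl
toFront-↭ (suc i) (x ∷ xs) with toFront i xs | toFront-↭ i xs
... | []     | π = prep x π
... | y ∷ ys | π = ↭-trans (swap y x ↭-refl) (prep x π)

-- Lehmer codes: at each step, the next entry is the position of the element to be taken
-- among those that remain.
reorder : ∀ {A : Set} → List ℕ → List A → List A
reorder []       xs = xs
reorder (i ∷ is) xs with toFront i xs
... | []     = []
... | y ∷ ys = y ∷ reorder is ys

reorder-↭ : ∀ {A : Set} is (xs : List A) → reorder is xs ↭ xs
reorder-↭ []       xs = ↭-refl
reorder-↭ (i ∷ is) xs with toFront i xs | toFront-↭ i xs
... | []     | π = π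
... | y ∷ ys | π = ↭-trans (prep y (reorder-↭ is ys)) π

infixl 5 _▹_
-- With concrete codes the reordered list is computed by normalisation, so each exchange between the
-- two sides of a partition needs no separate permutation proof.
_▹_ : ∀ {A : Set} {xs N : List A} → xs ↭ N → (is : List ℕ) → reorder is xs ↭ N
_▹_ {xs = xs} π is = ↭-trans (reorder-↭ is xs) π

-- Colourings around a vertex of degree at most six

-- Non-edges count as a third colour, so that a single function `col` carries both the graph H and
-- its colouring.
data Colour : Set where
  red blue none : Colour

module ColouredGraph
  {V : Set} (col : V → V → Colour)
  (col-sym : ∀ x y → col x y ≡ col y x)
  (col-irr : ∀ x → col x x ≡ none)
  (noK₃ : ∀ {x y z} → col x y ≡ red → col x z ≡ red → col y z ≡ red → ⊥)
  (noK₄ : ∀ {w x y z} → col w x ≡ blue → col w y ≡ blue → col w z ≡ blue →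
          col x y ≡ blue × col x z ≡ blue × col y z ≡ blue → ⊥)
  where

  R B Z : V → V → Set
  R x y = col x y ≡ red
  B x y = col x y ≡ blue
  Z x y = col x y ≡ none

  Tri : V → V → V → Set
  Tri x y z = B x y × B x z × B y z

  flip : ∀ {x y κ} → col x y ≡ κ → col y x ≡ κ
  flip {x} {y} e = trans (col-sym y x) e

  R? : ∀ x y → Dec (R x y)
  R? x y with col x y
  ... | red  = yes refl
  ... | blue = no λ ()
  ... | none = no λ ()

  B? : ∀ x y → Dec (B x y)
  B? x y with col x y
  ... | red  = no λ ()
  ... | blue = yes refl
  ... | none = no λ ()

  Tri? : ∀ x y z → Dec (Tri x y z)
  Tri? x y z = B? x y ×-dec B? x z ×-dec B? y z

  R⇒¬B : ∀ {x y} → R x y → ¬ B x y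
  R⇒¬B r b = case trans (sym r) b of λ ()

  B⇒¬R : ∀ {x y} → B x y → ¬ R x y
  B⇒¬R b r = R⇒¬B r b

  Z-intro : ∀ {x y} → ¬ R x y → ¬ B x y → Z x y
  Z-intro {x} {y} ¬r ¬b with col x y
  ... | red  = ⊥-elim (¬r refl)
  ... | blue = ⊥-elim (¬b refl)
  ... | none = refl

  R⊎Z : ∀ {x y} → ¬ B x y → R x y ⊎ Z x y
  R⊎Z {x} {y} ¬b with R? x y
  ... | yes r = inj₁ r
  ... | no ¬r = inj₂ (Z-intro ¬r ¬b)

  RedFree : List V → Set
  RedFree = AllPairs (λ x y → ¬ R x y)

  data TriFree : List V → Set where
    []  : TriFree []
    _∷_ : ∀ {x xs} → AllPairs (λ y z → ¬ Tri x y z) xs → TriFree xs → TriFree (x ∷ xs)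

  data BlueEdge (u : V) : List V → Set where
    here  : ∀ {x xs} → B u x → Any (λ y → B x y × B u y) xs → BlueEdge u (x ∷ xs)
    there : ∀ {x xs} → BlueEdge u xs → BlueEdge u (x ∷ xs)

  triFree₂ : ∀ {x y} → TriFree (x ∷ y ∷ [])
  triFree₂ = ([] ∷ []) ∷ [] ∷ []

  triFree₃ : ∀ {x y z} → ¬ Tri x y z → TriFree (x ∷ y ∷ z ∷ [])
  triFree₃ xyz = ((xyz ∷ []) ∷ [] ∷ []) ∷ triFree₂

  triFree₄ : ∀ {w x y z} → ¬ Tri w x y → ¬ Tri w x z → ¬ Tri w y z → ¬ Tri x y z →
             TriFree (w ∷ x ∷ y ∷ z ∷ [])
  triFree₄ wxy wxz wyz xyz = ((wxy ∷ wxz ∷ []) ∷ (wyz ∷ []) ∷ [] ∷ []) ∷ triFree₃ xyz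

  -- An independent set of H, given as a predicate so that outside vertices can be sorted by their
  -- colours towards N.
  record Class : Set₁ where
    field
      _∋_   : V → Set
      indep : ∀ {x y} → _∋_ x → _∋_ y → Z x y
  open Class public

  ∅ : Class
  ∅ = record { _∋_ = λ _ → ⊥ ; indep = λ () }

  -- Independent because a red edge inside it would close a red triangle with `a`, and a blue one a
  -- blue K₄ with the edge `bc`.
  same : ∀ a b c → B b c → Class
  same a b c bc ._∋_ u = R u a × B u b × B u c
  same a b c bc .indep {u} {u′} (ua , ub , uc) (u′a , u′b , u′c) =
    Z-intro (λ uu′ → noK₃ uu′ ua u′a) (λ uu′ → noK₄ uu′ ub uc (u′b , u′c , bc))

  -- Lets the members of `C` that miss `x` reuse its colour; the other members drop out and must be
  -- covered elsewhere.
  _⊕_ : Class → V → Class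
  (C ⊕ x) ._∋_ y = y ≡ x ⊎ (C ∋ y × Z y x)
  (C ⊕ x) .indep (inj₁ refl)     (inj₁ refl)     = col-irr x
  (C ⊕ x) .indep (inj₁ refl)     (inj₂ (_ , zx)) = flip zx
  (C ⊕ x) .indep (inj₂ (_ , zx)) (inj₁ refl)     = zx
  (C ⊕ x) .indep (inj₂ (p , _))  (inj₂ (q , _))  = indep C p q

  independent : ∀ xs → AllPairs Z xs → Class
  independent xs _ ._∋_ = _∈ xs
  independent xs zs .indep = go zs
    where
    head-Z : ∀ {x y ys} → All (Z x) ys → y ∈ ys → Z x y
    head-Z (z ∷ _)  (here refl) = z
    head-Z (_ ∷ zs) (there i)   = head-Z zs i
    go : ∀ {xs x y} → AllPairs Z xs → x ∈ xs → y ∈ xs → Z x y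
    go (_ ∷ _)  (here refl) (here refl) = col-irr _
    go (h ∷ _)  (here refl) (there j)   = head-Z h j
    go (h ∷ _)  (there i)   (here refl) = flip (head-Z h i)
    go (_ ∷ zs) (there i)   (there j)   = go zs i j

  -- Eight colours, because such a colouring maps H homomorphically to K₈, from which a critical
  -- colouring can be pulled back.
  Colourable : Set
  Colourable = Σ (V → Fin 8) λ f → ∀ {x y} → ¬ Z x y → f x ≢ f y

  -- A partition of N is encoded as an ordering of N that is cut after its first k entries.
  module Critical
    (N : List V) (Out : V → Set)
    (cover : ∀ x → x ∈ N ⊎ Out x ⊎ (∀ y → Z x y))
    {u₀ : V} (out₀ : Out u₀)
    (hits : ∀ k {xs} → xs ↭ N → RedFree (take k xs) → TriFree (drop k xs) →
            ∀ {u} → Out u → Any (R u) (take k xs) × BlueEdge u (drop k xs))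
    where

    -- Eight-colourings assembled from independent classes

    colouring : (cs : Vec Class 8) →
                (∀ {x} → x ∈ N → Σ (Fin 8) λ i → lookup cs i ∋ x) →
                (∀ {x} → Out x → Σ (Fin 8) λ i → lookup cs i ∋ x) → Colourable
    colouring cs inN inOut = (λ x → f x (cover x)) , λ {x} {y} → proper (cover x) (cover y)
      where
      f : ∀ x → x ∈ N ⊎ Out x ⊎ (∀ y → Z x y) → Fin 8
      f x (inj₁ i)        = proj₁ (inN i)
      f x (inj₂ (inj₁ o)) = proj₁ (inOut o)
      -- An isolated vertex may take any colour; `0F` is an arbitrary default.
      f x (inj₂ (inj₂ z)) = 0F
      class : ∀ {x} (c : x ∈ N ⊎ Out x ⊎ (∀ y → Z x y)) →
              lookup cs (f x c) ∋ x ⊎ (∀ y → Z x y)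
      class (inj₁ i)        = inj₁ (proj₂ (inN i))
      class (inj₂ (inj₁ o)) = inj₁ (proj₂ (inOut o))
      class (inj₂ (inj₂ z)) = inj₂ z
      proper : ∀ {x y} cx cy → ¬ Z x y → f x cx ≢ f y cy
      proper {x} {y} cx cy ¬z e with class cx | class cy
      ... | inj₂ z | _      = ¬z (z y)
      ... | inj₁ _ | inj₂ z = ¬z (flip (z x))
      ... | inj₁ p | inj₁ q =
        ¬z (indep (lookup cs (f x cx)) p (subst (λ i → lookup cs i ∋ y) (sym e) q))

    -- N takes six colours and `E`, `F` the two fresh ones; an outside vertex may also reuse the
    -- colour of `x` or `y` if it misses that vertex.
    colouring₆ : ∀ {x y z₁ z₂ z₃ z₄} → x ∷ y ∷ z₁ ∷ z₂ ∷ z₃ ∷ z₄ ∷ [] ↭ N →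
                 (C D E F : Class) →
                 (∀ {u} → Out u → (C ∋ u × Z u x) ⊎ (D ∋ u × Z u y) ⊎ E ∋ u ⊎ F ∋ u) →
                 Colourable
    colouring₆ {x} {y} {z₁} {z₂} {z₃} {z₄} π C D E F g =
      colouring (C ⊕ x ∷ D ⊕ y ∷ ∅ ⊕ z₁ ∷ ∅ ⊕ z₂ ∷ ∅ ⊕ z₃ ∷ ∅ ⊕ z₄ ∷ E ∷ F ∷ [])
        (λ i → inN (∈-resp-↭ (↭-sym π) i)) λ o → inOut (g o)
      where
      cs = C ⊕ x ∷ D ⊕ y ∷ ∅ ⊕ z₁ ∷ ∅ ⊕ z₂ ∷ ∅ ⊕ z₃ ∷ ∅ ⊕ z₄ ∷ E ∷ F ∷ []
      inN : ∀ {v} → v ∈ x ∷ y ∷ z₁ ∷ z₂ ∷ z₃ ∷ z₄ ∷ [] → Σ (Fin 8) λ i → lookup cs i ∋ v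
      inN (here e)                                 = 0F , inj₁ e
      inN (there (here e))                         = 1F , inj₁ e
      inN (there (there (here e)))                 = 2F , inj₁ e
      inN (there (there (there (here e))))         = 3F , inj₁ e
      inN (there (there (there (there (here e))))) = 4F , inj₁ e
      inN (there (there (there (there (there (here e)))))) = 5F , inj₁ e
      inOut : ∀ {u} → (C ∋ u × Z u x) ⊎ (D ∋ u × Z u y) ⊎ E ∋ u ⊎ F ∋ u →
              Σ (Fin 8) λ i → lookup cs i ∋ u
      inOut (inj₁ c)               = 0F , inj₂ c
      inOut (inj₂ (inj₁ d))        = 1F , inj₂ d
      inOut (inj₂ (inj₂ (inj₁ e))) = 6F , e
      inOut (inj₂ (inj₂ (inj₂ f))) = 7F , f

    colouring₂ : ∀ {x y z₁ z₂ z₃ z₄} → x ∷ y ∷ z₁ ∷ z₂ ∷ z₃ ∷ z₄ ∷ [] ↭ N →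
                 (E F : Class) → (∀ {u} → Out u → E ∋ u ⊎ F ∋ u) → Colourable
    colouring₂ π E F g = colouring₆ π ∅ ∅ E F λ o → inj₂ (inj₂ (g o))

    -- Merging the non-adjacent `x` and `y` reduces N to five colours and leaves three fresh ones.
    colouring₅ : ∀ {x y z₁ z₂ z₃ z₄} → x ∷ y ∷ z₁ ∷ z₂ ∷ z₃ ∷ z₄ ∷ [] ↭ N → Z x y →
                 (C D E : Class) → (∀ {u} → Out u → C ∋ u ⊎ D ∋ u ⊎ E ∋ u) → Colourable
    colouring₅ {x} {y} {z₁} {z₂} {z₃} {z₄} π xy C D E g =
      colouring cs (λ i → inN (∈-resp-↭ (↭-sym π) i)) λ o → inOut (g o)
      where
      cs = independent (x ∷ y ∷ []) ((xy ∷ []) ∷ [] ∷ [])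
           ∷ ∅ ⊕ z₁ ∷ ∅ ⊕ z₂ ∷ ∅ ⊕ z₃ ∷ ∅ ⊕ z₄ ∷ C ∷ D ∷ E ∷ []
      inN : ∀ {v} → v ∈ x ∷ y ∷ z₁ ∷ z₂ ∷ z₃ ∷ z₄ ∷ [] → Σ (Fin 8) λ i → lookup cs i ∋ v
      inN (here e)                                 = 0F , here e
      inN (there (here e))                         = 0F , there (here e)
      inN (there (there (here e)))                 = 1F , inj₁ e
      inN (there (there (there (here e))))         = 2F , inj₁ e
      inN (there (there (there (there (here e))))) = 3F , inj₁ e
      inN (there (there (there (there (there (here e)))))) = 4F , inj₁ e
      inOut : ∀ {u} → C ∋ u ⊎ D ∋ u ⊎ E ∋ u → Σ (Fin 8) λ i → lookup cs i ∋ u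
      inOut (inj₁ c)        = 5F , c
      inOut (inj₂ (inj₁ d)) = 6F , d
      inOut (inj₂ (inj₂ e)) = 7F , e

    -- The four independent vertices share a colour, so N takes three colours; four more go to the
    -- outside and one class stays empty.
    colouring₃ : ∀ {p q r s b c} → p ∷ q ∷ r ∷ s ∷ b ∷ c ∷ [] ↭ N →
                 AllPairs Z (p ∷ q ∷ r ∷ s ∷ []) →
                 (C D E F : Class) → (∀ {u} → Out u → C ∋ u ⊎ D ∋ u ⊎ E ∋ u ⊎ F ∋ u) → Colourable
    colouring₃ {p} {q} {r} {s} {b} {c} π zs C D E F g =
      colouring cs (λ i → inN (∈-resp-↭ (↭-sym π) i)) λ o → inOut (g o)
      where
      cs = independent (p ∷ q ∷ r ∷ s ∷ []) zs ∷ ∅ ⊕ b ∷ ∅ ⊕ c ∷ ∅ ∷ C ∷ D ∷ E ∷ F ∷ []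
      inN : ∀ {v} → v ∈ p ∷ q ∷ r ∷ s ∷ b ∷ c ∷ [] → Σ (Fin 8) λ i → lookup cs i ∋ v
      inN (here e)                                 = 0F , here e
      inN (there (here e))                         = 0F , there (here e)
      inN (there (there (here e)))                 = 0F , there (there (here e))
      inN (there (there (there (here e))))         = 0F , there (there (there (here e)))
      inN (there (there (there (there (here e))))) = 1F , inj₁ e
      inN (there (there (there (there (there (here e)))))) = 2F , inj₁ e
      inOut : ∀ {u} → C ∋ u ⊎ D ∋ u ⊎ E ∋ u ⊎ F ∋ u → Σ (Fin 8) λ i → lookup cs i ∋ u
      inOut (inj₁ c)               = 4F , c
      inOut (inj₂ (inj₁ d))        = 5F , d
      inOut (inj₂ (inj₂ (inj₁ e))) = 6F , e
      inOut (inj₂ (inj₂ (inj₂ f))) = 7F , f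

    -- Partitions with three or four vertices in A

    -- If a vertex of A can move to B, two classes suffice outside. Otherwise each vertex of A lies
    -- in a blue triangle with `b` and one of `c`, `s`. Two of the three use the same third vertex,
    -- so a blue edge between them would make a blue K₄: they are non-adjacent and merge, which
    -- leaves a fresh colour for each vertex of A.
    oneEdge : ∀ {p q r b c s} → p ∷ q ∷ r ∷ b ∷ c ∷ s ∷ [] ↭ N → RedFree (p ∷ q ∷ r ∷ []) →
              B b c → ¬ B c s → (∀ {u} → Out u → B u b × B u c) → Colourable
    oneEdge {p} {q} {r} {b} {c} {s} π ((pq ∷ pr ∷ []) ∷ (qr ∷ []) ∷ [] ∷ []) bc ¬cs both
      with movable π qr | movable (π ▹ (1 ∷ 0 ∷ [])) pr | movable (π ▹ (2 ∷ 0 ∷ [])) pq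
      where
      movable : ∀ {x y z} → x ∷ y ∷ z ∷ b ∷ c ∷ s ∷ [] ↭ N → ¬ R y z →
                Colourable ⊎ (B b x × (B c x ⊎ (B b s × B s x)))
      movable {x} {y} {z} π yz with Tri? x b c | Tri? x b s
      ... | yes (xb , xc , _) | _ = inj₂ (flip xb , inj₁ (flip xc))
      ... | no _ | yes (xb , xs , bs) = inj₂ (flip xb , inj₂ (bs , flip xs))
      -- With `x` moved to B, every outside vertex is red to `y` or `z`. The other two triples of B
      -- contain the non-blue pair `cs`.
      ... | no xbc | no xbs = inj₁ (colouring₂ π (same y b c bc) (same z b c bc) λ o →
        case proj₁ (hits 2 (π ▹ (1 ∷ 1 ∷ [])) ((yz ∷ []) ∷ [] ∷ [])
                      (triFree₄ xbc xbs (¬cs ∘ proj₂ ∘ proj₂) (¬cs ∘ proj₂ ∘ proj₂)) o) of λ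
          { (here uy)         → inj₁ (uy , both o)
          ; (there (here uz)) → inj₂ (uz , both o) })
    ... | inj₁ C | _ | _ = C
    ... | inj₂ _ | inj₁ C | _ = C
    ... | inj₂ _ | inj₂ _ | inj₁ C = C
    ... | inj₂ (bp , tp) | inj₂ (bq , tq) | inj₂ (br , tr) = twoAlike tp tq tr
      where
      T : V → Set
      T x = B c x ⊎ (B b s × B s x)
      merged : ∀ {x y z} → x ∷ y ∷ z ∷ b ∷ c ∷ s ∷ [] ↭ N → ¬ R x y →
               RedFree (x ∷ y ∷ z ∷ []) → ¬ B x y → Colourable
      merged {x} {y} {z} π xy rf ¬xy =
        colouring₅ π (Z-intro xy ¬xy) (same x b c bc) (same y b c bc) (same z b c bc) λ o →
        case proj₁ (hits 3 π rf (triFree₃ (¬cs ∘ proj₂ ∘ proj₂)) o) of λ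
          { (here ux)                 → inj₁ (ux , both o)
          ; (there (here uy))         → inj₂ (inj₁ (uy , both o))
          ; (there (there (here uz))) → inj₂ (inj₂ (uz , both o)) }
      mergePQ : ¬ B p q → Colourable
      mergePQ = merged π pq ((pq ∷ pr ∷ []) ∷ (qr ∷ []) ∷ [] ∷ [])
      mergePR : ¬ B p r → Colourable
      mergePR = merged (π ▹ (0 ∷ 1 ∷ [])) pr ((pr ∷ pq ∷ []) ∷ (qr ∘ flip ∷ []) ∷ [] ∷ [])
      mergeQR : ¬ B q r → Colourable
      mergeQR = merged (π ▹ (1 ∷ 1 ∷ [])) qr ((qr ∷ pq ∘ flip ∷ []) ∷ (pr ∘ flip ∷ []) ∷ [] ∷ [])
      twoAlike : T p → T q → T r → Colourable
      twoAlike (inj₁ cp) (inj₁ cq) _ = mergePQ λ e → noK₄ bc bp bq (cp , cq , e)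
      twoAlike (inj₁ cp) (inj₂ _) (inj₁ cr) = mergePR λ e → noK₄ bc bp br (cp , cr , e)
      twoAlike (inj₁ _) (inj₂ (bs , sq)) (inj₂ (_ , sr)) = mergeQR λ e → noK₄ bs bq br (sq , sr , e)
      twoAlike (inj₂ (bs , sp)) (inj₂ (_ , sq)) _ = mergePQ λ e → noK₄ bs bp bq (sp , sq , e)
      twoAlike (inj₂ (bs , sp)) (inj₁ _) (inj₂ (_ , sr)) = mergePR λ e → noK₄ bs bp br (sp , sr , e)
      twoAlike (inj₂ _) (inj₁ cq) (inj₁ cr) = mergeQR λ e → noK₄ bc bq br (cq , cr , e)

    -- `s` lacks a blue edge to `b` or to `c`, and these two play symmetric roles.
    oneEdge-either : ∀ {p q r b c s} → p ∷ q ∷ r ∷ b ∷ c ∷ s ∷ [] ↭ N → RedFree (p ∷ q ∷ r ∷ []) →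
               B b c → ¬ Tri b c s → (∀ {u} → Out u → B u b × B u c) → Colourable
    oneEdge-either {b = b} {c} {s} π rf bc bcs both with B? c s
    ... | no ¬cs = oneEdge π rf bc ¬cs both
    ... | yes cs = oneEdge (π ▹ (0 ∷ 0 ∷ 0 ∷ 1 ∷ [])) rf (flip bc) (λ bs → bcs (bc , bs , cs))
                     λ o → proj₂ (both o) , proj₁ (both o)

    -- Only `bc` can be a blue edge of B, so it is the one that `hits` supplies for every outside
    -- vertex; `out₀` shows that it is blue.
    side₃-oneEdge : ∀ {p q r b c s} → p ∷ q ∷ r ∷ b ∷ c ∷ s ∷ [] ↭ N → RedFree (p ∷ q ∷ r ∷ []) →
             ¬ B b s → ¬ B c s → Colourable
    side₃-oneEdge {b = b} {c} {s} π rf ¬bs ¬cs =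
      oneEdge π rf (proj₁ (edge out₀)) ¬cs (proj₂ ∘ edge)
      where
      edge : ∀ {u} → Out u → B b c × B u b × B u c
      edge o with proj₂ (hits 3 π rf (triFree₃ (¬cs ∘ proj₂ ∘ proj₂)) o)
      ... | here ub (here (bc , uc))         = bc , ub , uc
      ... | here ub (there (here (bs , _)))  = ⊥-elim (¬bs bs)
      ... | there (here uc (here (cs , _)))  = ⊥-elim (¬cs cs)
      ... | there (there (here _ ()))

    -- The blue edge of B is `bc`. A vertex of A that forms no blue triangle with it moves to B. If
    -- there is none, a blue edge inside A would give a blue K₄ with `bc`, so the four vertices of A
    -- are independent and share a colour.
    side₄ : ∀ {p q r s b c} → p ∷ q ∷ r ∷ s ∷ b ∷ c ∷ [] ↭ N → RedFree (p ∷ q ∷ r ∷ s ∷ []) →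
           Colourable
    side₄ {p} {q} {r} {s} {b} {c} π
      rf@((pq ∷ pr ∷ ps ∷ []) ∷ (qr ∷ qs ∷ []) ∷ (rs ∷ []) ∷ [] ∷ []) =
      go (Tri? b c p) (Tri? b c q) (Tri? b c r) (Tri? b c s)
      where
      edge : ∀ {u} → Out u → B b c × B u b × B u c
      edge o with proj₂ (hits 4 π rf triFree₂ o)
      ... | here ub (here (bc , uc)) = bc , ub , uc
      ... | there (here _ ())
      bc = proj₁ (edge out₀)
      move : ∀ {x y z w} → x ∷ y ∷ z ∷ b ∷ c ∷ w ∷ [] ↭ N → RedFree (x ∷ y ∷ z ∷ []) →
             ¬ Tri b c w → Colourable
      move π′ rf′ t = oneEdge-either π′ rf′ bc t (proj₂ ∘ edge)
      apart : ∀ {x y} → Tri b c x → Tri b c y → ¬ R x y → Z x y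
      apart (_ , bx , cx) (_ , by , cy) ¬r = Z-intro ¬r λ xy → noK₄ bc bx by (cx , cy , xy)
      go : Dec (Tri b c p) → Dec (Tri b c q) → Dec (Tri b c r) → Dec (Tri b c s) → Colourable
      go (no t) _ _ _ = move (π ▹ (1 ∷ 1 ∷ 1 ∷ 1 ∷ 1 ∷ [])) ((qr ∷ qs ∷ []) ∷ (rs ∷ []) ∷ [] ∷ []) t
      go _ (no t) _ _ = move (π ▹ (0 ∷ 1 ∷ 1 ∷ 1 ∷ 1 ∷ [])) ((pr ∷ ps ∷ []) ∷ (rs ∷ []) ∷ [] ∷ []) t
      go _ _ (no t) _ = move (π ▹ (0 ∷ 0 ∷ 1 ∷ 1 ∷ 1 ∷ [])) ((pq ∷ ps ∷ []) ∷ (qs ∷ []) ∷ [] ∷ []) t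
      go _ _ _ (no t) = move (π ▹ (0 ∷ 0 ∷ 0 ∷ 1 ∷ 1 ∷ [])) ((pq ∷ pr ∷ []) ∷ (qr ∷ []) ∷ [] ∷ []) t
      go (yes tp) (yes tq) (yes tr) (yes ts) =
        colouring₃ π
          ((apart tp tq pq ∷ apart tp tr pr ∷ apart tp ts ps ∷ [])
            ∷ (apart tq tr qr ∷ apart tq ts qs ∷ []) ∷ (apart tr ts rs ∷ []) ∷ [] ∷ [])
          (same p b c bc) (same q b c bc) (same r b c bc) (same s b c bc) λ o →
        case proj₁ (hits 4 π rf triFree₂ o) of λ
          { (here up)                         → inj₁ (up , proj₂ (edge o))
          ; (there (here uq))                 → inj₂ (inj₁ (uq , proj₂ (edge o)))
          ; (there (there (here ur)))         → inj₂ (inj₂ (inj₁ (ur , proj₂ (edge o))))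
          ; (there (there (there (here us)))) → inj₂ (inj₂ (inj₂ (us , proj₂ (edge o)))) }

    -- A = {p, q, r} and the blue edges of B form the path b₁ β b₃.  A vertex of A is stuck if moving
    -- it to B creates a blue triangle; r is never stuck.
    module Path {p q r b₁ β b₃} (π : p ∷ q ∷ r ∷ b₁ ∷ β ∷ b₃ ∷ [] ↭ N)
      (pq : ¬ R p q) (pr : ¬ R p r) (qr : ¬ R q r)
      (rβ : R r β) (b₁β : B b₁ β) (βb₃ : B β b₃) (¬b₁b₃ : ¬ B b₁ b₃) where

      Stuck : V → Set
      Stuck x = B x β × (B x b₁ ⊎ B x b₃)

      edge : ∀ {u} → Out u → B u β × (B u b₁ ⊎ B u b₃)
      edge o with proj₂ (hits 3 π ((pq ∷ pr ∷ []) ∷ (qr ∷ []) ∷ [] ∷ [])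
                           (triFree₃ (¬b₁b₃ ∘ proj₁ ∘ proj₂)) o)
      ... | here u₁ (here (_ , uβ))            = uβ , inj₁ u₁
      ... | here _ (there (here (b₁b₃ , _)))   = ⊥-elim (¬b₁b₃ b₁b₃)
      ... | there (here uβ (here (_ , u₃)))    = uβ , inj₂ u₃
      ... | there (there (here _ ()))

      -- Here `r` has moved to B: each triple of the new B contains the red pair `rβ` or the
      -- non-blue pair `b₁b₃`.
      p⊎q : ∀ {u} → Out u → R u p ⊎ R u q
      p⊎q o with proj₁ (hits 2 π ((pq ∷ []) ∷ [] ∷ [])
                          (triFree₄ (R⇒¬B rβ ∘ proj₁ ∘ proj₂) (¬b₁b₃ ∘ proj₂ ∘ proj₂)
                                    (R⇒¬B rβ ∘ proj₁) (¬b₁b₃ ∘ proj₁ ∘ proj₂)) o)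
      ... | here up         = inj₁ up
      ... | there (here uq) = inj₂ uq

      move : ∀ {x y z} → x ∷ y ∷ z ∷ b₁ ∷ β ∷ b₃ ∷ [] ↭ N → ¬ R y z → ¬ Stuck x →
             ∀ {u} → Out u → R u y ⊎ R u z
      move π′ yz ¬s o with proj₁ (hits 2 (π′ ▹ (1 ∷ 1 ∷ [])) ((yz ∷ []) ∷ [] ∷ [])
                          (triFree₄ (λ { (x₁ , xβ , _) → ¬s (xβ , inj₁ x₁) }) (¬b₁b₃ ∘ proj₂ ∘ proj₂)
                                    (λ { (xβ , x₃ , _) → ¬s (xβ , inj₂ x₃) }) (¬b₁b₃ ∘ proj₁ ∘ proj₂)) o)
      ... | here uy         = inj₁ uy
      ... | there (here uz) = inj₂ uz

      -- Without a red neighbour in A, `b₁` could join A, and `side₄` would apply.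
      R-b₁ : Colourable ⊎ (R p b₁ ⊎ R q b₁ ⊎ R r b₁)
      R-b₁ with R? p b₁ | R? q b₁ | R? r b₁
      ... | yes e | _ | _ = inj₂ (inj₁ e)
      ... | _ | yes e | _ = inj₂ (inj₂ (inj₁ e))
      ... | _ | _ | yes e = inj₂ (inj₂ (inj₂ e))
      ... | no np | no nq | no nr =
        inj₁ (side₄ π ((pq ∷ pr ∷ np ∷ []) ∷ (qr ∷ nq ∷ []) ∷ (nr ∷ []) ∷ [] ∷ []))

      -- Each of `p`, `q`, `r` can move to B, so an outside vertex is red to two of them. Any two
      -- such pairs meet, hence the blue edge alone determines an independent class.
      noneStuck : ¬ Stuck p → ¬ Stuck q → Colourable
      noneStuck ¬sp ¬sq = colouring₂ π (twoRed b₁ (flip b₁β)) (twoRed b₃ βb₃) cases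
        where
        Two : V → Set
        Two u = (R u p × R u q) ⊎ (R u p × R u r) ⊎ (R u q × R u r)
        common : ∀ {u u′} → Two u → Two u′ → ¬ R u u′
        common (inj₁ (up , _)) (inj₁ (u′p , _)) e = noK₃ e up u′p
        common (inj₁ (up , _)) (inj₂ (inj₁ (u′p , _))) e = noK₃ e up u′p
        common (inj₁ (_ , uq)) (inj₂ (inj₂ (u′q , _))) e = noK₃ e uq u′q
        common (inj₂ (inj₁ (up , _))) (inj₁ (u′p , _)) e = noK₃ e up u′p
        common (inj₂ (inj₁ (up , _))) (inj₂ (inj₁ (u′p , _))) e = noK₃ e up u′p
        common (inj₂ (inj₁ (_ , ur))) (inj₂ (inj₂ (_ , u′r))) e = noK₃ e ur u′r
        common (inj₂ (inj₂ (uq , _))) (inj₁ (_ , u′q)) e = noK₃ e uq u′q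
        common (inj₂ (inj₂ (_ , ur))) (inj₂ (inj₁ (_ , u′r))) e = noK₃ e ur u′r
        common (inj₂ (inj₂ (uq , _))) (inj₂ (inj₂ (u′q , _))) e = noK₃ e uq u′q
        twoRed : ∀ b → B β b → Class
        twoRed b βb ._∋_ u = Two u × B u β × B u b
        twoRed b βb .indep (t , uβ , ub) (t′ , u′β , u′b) =
          Z-intro (common t t′) λ e → noK₄ e uβ ub (u′β , u′b , βb)
        redTwice : ∀ {u} → Out u → Two u
        redTwice o with p⊎q o | move π qr ¬sp o | move (π ▹ (1 ∷ [])) pr ¬sq o
        ... | inj₁ up | inj₁ uq | _       = inj₁ (up , uq)
        ... | inj₁ up | inj₂ ur | _       = inj₂ (inj₁ (up , ur))
        ... | inj₂ uq | _       | inj₁ up = inj₁ (up , uq)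
        ... | inj₂ uq | _       | inj₂ ur = inj₂ (inj₂ (uq , ur))
        cases : ∀ {u} → Out u → (Two u × B u β × B u b₁) ⊎ (Two u × B u β × B u b₃)
        cases o with edge o
        ... | uβ , inj₁ u₁ = inj₁ (redTwice o , uβ , u₁)
        ... | uβ , inj₂ u₃ = inj₂ (redTwice o , uβ , u₃)

      -- An outside vertex blue to `b₁` and `β` is not blue to `p`, and one blue to `β` and `b₃` is
      -- not blue to `q`. It is red to that vertex and enters a fresh class, or misses it and reuses
      -- its colour.
      crossed : B p β → B q β → B p b₁ → B q b₃ → Colourable
      crossed pβ qβ p₁ q₃ =
        colouring₆ π (same q b₁ β b₁β) (same p β b₃ βb₃) (same p b₁ β b₁β) (same q β b₃ βb₃) λ o →
        cases o (edge o) (p⊎q o)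
        where
        cases : ∀ {u} → Out u → B u β × (B u b₁ ⊎ B u b₃) → R u p ⊎ R u q → _
        cases {u} o (uβ , inj₁ u₁) e with R⊎Z {u} {p} (λ up → noK₄ up u₁ uβ (p₁ , pβ , b₁β)) | e
        ... | inj₁ up | _       = inj₂ (inj₂ (inj₁ (up , u₁ , uβ)))
        ... | inj₂ zp | inj₂ uq = inj₁ ((uq , u₁ , uβ) , zp)
        ... | inj₂ zp | inj₁ up = case trans (sym zp) up of λ ()
        cases {u} o (uβ , inj₂ u₃) e with R⊎Z {u} {q} (λ uq → noK₄ uq uβ u₃ (qβ , q₃ , βb₃)) | e
        ... | inj₁ uq | _       = inj₂ (inj₂ (inj₂ (uq , uβ , u₃)))
        ... | inj₂ zq | inj₁ up = inj₂ (inj₁ ((up , uβ , u₃) , zq))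
        ... | inj₂ zq | inj₂ uq = case trans (sym zq) uq of λ ()

      -- `b₁` is blue to `p` and `q`, so its red neighbour in A is `r`. Exchanging `r` with `β` then
      -- leaves `rb₃` as the only possible blue edge of B.
      parallel : B p β → B q β → B p b₁ → B q b₁ → Colourable
      parallel pβ qβ p₁ q₁ with R-b₁
      ... | inj₁ C = C
      ... | inj₂ (inj₁ e) = ⊥-elim (R⇒¬B e p₁)
      ... | inj₂ (inj₂ (inj₁ e)) = ⊥-elim (R⇒¬B e q₁)
      ... | inj₂ (inj₂ (inj₂ r₁)) =
        side₃-oneEdge (π ▹ (4 ∷ 0 ∷ 0 ∷ 0 ∷ 1 ∷ []))
          ((B⇒¬R (flip pβ) ∷ B⇒¬R (flip qβ) ∷ []) ∷ (pq ∷ []) ∷ [] ∷ [])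
          (R⇒¬B r₁) (¬b₁b₃ ∘ flip)

      -- If `p` and `r` can move to B together, every outside vertex is red to `q`. Only a blue
      -- triangle of `p`, `r` and an end of the path can prevent this. With `b₁`, it leaves `b₁`
      -- without a red neighbour in A; with `b₃`, it forces `qb₃` to be red, and the colours of `q`
      -- and `b₃` are reused.
      oneStuck : ¬ Stuck p → B q β → B q b₁ → (Colourable ⊎ (R p b₃ ⊎ R q b₃ ⊎ R r b₃)) → Colourable
      oneStuck ¬sp qβ q₁ R-b₃ with Tri? p r b₁ | Tri? p r b₃
      ... | yes (_ , p₁ , r₁) | _ with R-b₁
      ...   | inj₁ C = C
      ...   | inj₂ (inj₁ e) = ⊥-elim (R⇒¬B e p₁)
      ...   | inj₂ (inj₂ (inj₁ e)) = ⊥-elim (R⇒¬B e q₁)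
      ...   | inj₂ (inj₂ (inj₂ e)) = ⊥-elim (R⇒¬B e r₁)
      oneStuck ¬sp qβ q₁ R-b₃ | no ¬pr₁ | no ¬pr₃ =
        colouring₂ π (same q b₁ β b₁β) (same q β b₃ βb₃) λ o → cases (edge o) (onlyQ o)
        where
        onlyQ : ∀ {u} → Out u → R u q
        onlyQ o with proj₁ (hits 1 (π ▹ (1 ∷ [])) ([] ∷ [])
          (((¬pr₁ ∷ R⇒¬B rβ ∘ proj₂ ∘ proj₂ ∷ ¬pr₃ ∷ [])
             ∷ ((λ { (p₁ , pβ , _) → ¬sp (pβ , inj₁ p₁) }) ∷ ¬b₁b₃ ∘ proj₂ ∘ proj₂ ∷ [])
             ∷ ((λ { (pβ , p₃ , _) → ¬sp (pβ , inj₂ p₃) }) ∷ []) ∷ [] ∷ [])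
           ∷ triFree₄ (R⇒¬B rβ ∘ proj₁ ∘ proj₂) (¬b₁b₃ ∘ proj₂ ∘ proj₂)
                      (R⇒¬B rβ ∘ proj₁) (¬b₁b₃ ∘ proj₁ ∘ proj₂)) o)
        ... | here uq = uq
        cases : ∀ {u} → B u β × (B u b₁ ⊎ B u b₃) → R u q → _
        cases (uβ , inj₁ u₁) uq = inj₁ (uq , u₁ , uβ)
        cases (uβ , inj₂ u₃) uq = inj₂ (uq , uβ , u₃)
      oneStuck ¬sp qβ q₁ R-b₃ | no ¬pr₁ | yes (_ , p₃ , r₃) with R-b₃
      ... | inj₁ C = C
      ... | inj₂ (inj₁ e) = ⊥-elim (R⇒¬B e p₃)
      ... | inj₂ (inj₂ (inj₂ e)) = ⊥-elim (R⇒¬B e r₃)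
      ... | inj₂ (inj₂ (inj₁ q₃)) =
        colouring₆ (π ▹ (1 ∷ 4 ∷ [])) (same p b₁ β b₁β) (same q b₁ β b₁β)
                   (same q β b₃ βb₃) (same p β b₃ βb₃) λ o → cases (edge o) (p⊎q o)
        where
        cases : ∀ {u} → B u β × (B u b₁ ⊎ B u b₃) → R u p ⊎ R u q → _
        cases (uβ , inj₂ u₃) (inj₁ up) = inj₂ (inj₂ (inj₂ (up , uβ , u₃)))
        cases (uβ , inj₂ u₃) (inj₂ uq) = inj₂ (inj₂ (inj₁ (uq , uβ , u₃)))
        cases {u} (uβ , inj₁ u₁) e with R⊎Z {u} {q} (λ uq → noK₄ uq u₁ uβ (q₁ , qβ , b₁β)) | e
        ... | inj₂ zq | inj₁ up = inj₁ ((up , u₁ , uβ) , zq)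
        ... | inj₂ zq | inj₂ uq = case trans (sym zq) uq of λ ()
        -- Since `uq` and `qb₃` are red, `ub₃` is not; if it is not blue either, `u` can take the
        -- colour of `b₃`.
        ... | inj₁ uq | _ with B? u b₃
        ...   | yes u₃ = inj₂ (inj₂ (inj₁ (uq , uβ , u₃)))
        ...   | no ¬u₃ = inj₂ (inj₁ ((uq , u₁ , uβ) , Z-intro (λ u₃ → noK₃ uq u₃ q₃) ¬u₃))

    stuck? : ∀ x β b₁ b₃ → Dec (B x β × (B x b₁ ⊎ B x b₃))
    stuck? x β b₁ b₃ = B? x β ×-dec (B? x b₁ ⊎-dec B? x b₃)

    pathRed : ∀ {p q r b₁ β b₃} → p ∷ q ∷ r ∷ b₁ ∷ β ∷ b₃ ∷ [] ↭ N →
              ¬ R p q → ¬ R p r → ¬ R q r → R r β → B b₁ β → B β b₃ → ¬ B b₁ b₃ → Colourable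
    pathRed {p} {q} {r} {b₁} {β} {b₃} π pq pr qr rβ b₁β βb₃ ¬b₁b₃ =
      go (stuck? p β b₁ b₃) (stuck? q β b₁ b₃)
      where
      -- A prime reverses the path `b₁ β b₃`; `QP` exchanges `p` and `q`.
      module PQ  = Path π pq pr qr rβ b₁β βb₃ ¬b₁b₃
      module PQ′ = Path (π ▹ (0 ∷ 0 ∷ 0 ∷ 2 ∷ 1 ∷ [])) pq pr qr rβ (flip βb₃) (flip b₁β) (¬b₁b₃ ∘ flip)
      module QP  = Path (π ▹ (1 ∷ [])) (pq ∘ flip) qr pr rβ b₁β βb₃ ¬b₁b₃
      module QP′ = Path (π ▹ (1 ∷ 0 ∷ 0 ∷ 2 ∷ 1 ∷ [])) (pq ∘ flip) qr pr rβ
                     (flip βb₃) (flip b₁β) (¬b₁b₃ ∘ flip)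
      go : Dec (PQ.Stuck p) → Dec (PQ.Stuck q) → Colourable
      go (no ¬sp) (no ¬sq) = PQ.noneStuck ¬sp ¬sq
      go (yes (pβ , inj₁ p₁)) (yes (qβ , inj₁ q₁)) = PQ.parallel pβ qβ p₁ q₁
      go (yes (pβ , inj₁ p₁)) (yes (qβ , inj₂ q₃)) = PQ.crossed pβ qβ p₁ q₃
      go (yes (pβ , inj₂ p₃)) (yes (qβ , inj₁ q₁)) = PQ′.crossed pβ qβ p₃ q₁
      go (yes (pβ , inj₂ p₃)) (yes (qβ , inj₂ q₃)) = PQ′.parallel pβ qβ p₃ q₃
      go (no ¬sp) (yes (qβ , inj₁ q₁)) = PQ.oneStuck ¬sp qβ q₁ PQ′.R-b₁
      go (no ¬sp) (yes (qβ , inj₂ q₃)) = PQ′.oneStuck (¬sp ∘ map₂ Sum.swap) qβ q₃ PQ.R-b₁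
      go (yes (pβ , inj₁ p₁)) (no ¬sq) = QP.oneStuck ¬sq pβ p₁ QP′.R-b₁
      go (yes (pβ , inj₂ p₃)) (no ¬sq) = QP′.oneStuck (¬sq ∘ map₂ Sum.swap) pβ p₃ QP.R-b₁

    -- If `β` has no red neighbour in A, it joins A; otherwise such a neighbour takes the role of
    -- `r`.
    path : ∀ {p q r b₁ β b₃} → p ∷ q ∷ r ∷ b₁ ∷ β ∷ b₃ ∷ [] ↭ N → RedFree (p ∷ q ∷ r ∷ []) →
           B b₁ β → B β b₃ → ¬ B b₁ b₃ → Colourable
    path {p} {q} {r} {b₁} {β} {b₃} π ((pq ∷ pr ∷ []) ∷ (qr ∷ []) ∷ [] ∷ []) b₁β βb₃ ¬b₁b₃
      with R? p β | R? q β | R? r β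
    ... | no ¬pβ | no ¬qβ | no ¬rβ =
      side₄ (π ▹ (0 ∷ 0 ∷ 0 ∷ 1 ∷ []))
        ((pq ∷ pr ∷ ¬pβ ∷ []) ∷ (qr ∷ ¬qβ ∷ []) ∷ (¬rβ ∷ []) ∷ [] ∷ [])
    ... | _ | _ | yes rβ = pathRed π pq pr qr rβ b₁β βb₃ ¬b₁b₃
    ... | _ | yes qβ | _ = pathRed (π ▹ (0 ∷ 1 ∷ [])) pr pq (qr ∘ flip) qβ b₁β βb₃ ¬b₁b₃
    ... | yes pβ | _ | _ =
      pathRed (π ▹ (1 ∷ 1 ∷ [])) qr (pq ∘ flip) (pr ∘ flip) pβ b₁β βb₃ ¬b₁b₃

    -- Two blue edges in B form a path; with fewer, some vertex of B lies on no blue edge of B.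
    side₃ : ∀ {p q r x y z} → p ∷ q ∷ r ∷ x ∷ y ∷ z ∷ [] ↭ N → RedFree (p ∷ q ∷ r ∷ []) →
            ¬ Tri x y z → Colourable
    side₃ {x = x} {y} {z} π rf ¬t with B? x y | B? x z | B? y z
    ... | yes xy | yes xz | yes yz = ⊥-elim (¬t (xy , xz , yz))
    ... | yes xy | yes xz | no ¬yz = path (π ▹ (0 ∷ 0 ∷ 0 ∷ 1 ∷ [])) rf (flip xy) xz ¬yz
    ... | yes xy | no ¬xz | yes yz = path π rf xy yz ¬xz
    ... | no ¬xy | yes xz | yes yz = path (π ▹ (0 ∷ 0 ∷ 0 ∷ 0 ∷ 1 ∷ [])) rf xz (flip yz) ¬xy
    ... | _      | no ¬xz | no ¬yz = side₃-oneEdge π rf ¬xz ¬yz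
    ... | no ¬xy | _      | no ¬yz = side₃-oneEdge (π ▹ (0 ∷ 0 ∷ 0 ∷ 0 ∷ 1 ∷ [])) rf ¬xy (¬yz ∘ flip)
    ... | no ¬xy | no ¬xz | _      =
      side₃-oneEdge (π ▹ (0 ∷ 0 ∷ 0 ∷ 1 ∷ 1 ∷ [])) rf (¬xy ∘ flip) (¬xz ∘ flip)

    -- Partitions with one or two vertices in A

    -- The red neighbours of `a` span no red edge, so three of them can serve as A.
    claw : ∀ {a x y z d e} → x ∷ y ∷ z ∷ a ∷ d ∷ e ∷ [] ↭ N → R a x → R a y → R a z →
           ¬ Tri a d e → Colourable
    claw π ax ay az =
      side₃ π (((λ xy → noK₃ ax ay xy) ∷ (λ xz → noK₃ ax az xz) ∷ [])
               ∷ ((λ yz → noK₃ ay az yz) ∷ []) ∷ [] ∷ [])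

    -- A further red edge between A and B gives a claw, and if `qwx` or `pyz` is not a blue
    -- triangle, a partition with three vertices in A arises. In the remaining case an outside
    -- vertex is blue to both ends of `wx` or of `yz`, hence not blue to `q` or `p` respectively: it
    -- is red to that vertex, or reuses its colour.
    balanced : ∀ {p q w x y z} → p ∷ q ∷ w ∷ x ∷ y ∷ z ∷ [] ↭ N →
               ¬ R p q → TriFree (w ∷ x ∷ y ∷ z ∷ []) →
               R p w → R p x → R q y → R q z →
               Colourable
    balanced {p} {q} {w} {x} {y} {z} π pq tf pw px qy qz
      with R? q w | R? q x | R? p y | R? p z | Tri? q w x | Tri? p y z
    ... | yes qw | _ | _ | _ | _ | _ =
      claw (π ▹ (2 ∷ 3 ∷ 3 ∷ 1 ∷ [])) qw qy qz (R⇒¬B px ∘ proj₂ ∘ proj₂)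
    ... | _ | yes qx | _ | _ | _ | _ =
      claw (π ▹ (3 ∷ 3 ∷ 3 ∷ 1 ∷ [])) qx qy qz (R⇒¬B pw ∘ proj₂ ∘ proj₂)
    ... | _ | _ | yes py | _ | _ | _ =
      claw (π ▹ (2 ∷ 2 ∷ 2 ∷ [])) pw px py (R⇒¬B qz ∘ proj₂ ∘ proj₂)
    ... | _ | _ | _ | yes pz | _ | _ =
      claw (π ▹ (2 ∷ 2 ∷ 3 ∷ [])) pw px pz (R⇒¬B qy ∘ proj₂ ∘ proj₂)
    ... | no ¬qw | no ¬qx | no ¬py | no ¬pz | no ¬qwx | _ =
      side₃ (π ▹ (0 ∷ 3 ∷ 3 ∷ []))
        ((¬py ∷ ¬pz ∷ []) ∷ ((λ yz → noK₃ qy qz yz) ∷ []) ∷ [] ∷ []) ¬qwx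
    ... | no ¬qw | no ¬qx | no ¬py | no ¬pz | _ | no ¬pyz =
      side₃ (π ▹ (1 ∷ 1 ∷ 1 ∷ []))
        ((¬qw ∷ ¬qx ∷ []) ∷ ((λ wx → noK₃ pw px wx) ∷ []) ∷ [] ∷ []) ¬pyz
    ... | no _ | no _ | no _ | no _ | yes (qw , qx , wx) | yes (py , pz , yz) =
      colouring₆ π (same q y z yz) (same p w x wx) (same q w x wx) (same p y z yz) λ o →
      cases (p⊎q o) (side o)
      where
      p⊎q : ∀ {u} → Out u → R u p ⊎ R u q
      p⊎q o with proj₁ (hits 2 π ((pq ∷ []) ∷ [] ∷ []) tf o)
      ... | here up         = inj₁ up
      ... | there (here uq) = inj₂ uq
      -- A blue edge between {w, x} and {y, z} is itself a red-free side, so no u sees it in blue.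
      noCross : ∀ {a b a′ b′} → p ∷ q ∷ a ∷ a′ ∷ b ∷ b′ ∷ [] ↭ N → R p a′ → R q b′ →
                ∀ {u} → Out u → B u a → B a b → B u b → ⊥
      noCross π′ pa′ qb′ o ua ab ub with proj₁ (hits 2 (π′ ▹ (2 ∷ 3 ∷ [])) ((B⇒¬R ab ∷ []) ∷ [] ∷ [])
        (triFree₄ (R⇒¬B pa′ ∘ proj₁ ∘ proj₂) (R⇒¬B qb′ ∘ proj₂ ∘ proj₂)
                  (R⇒¬B pa′ ∘ proj₁) (R⇒¬B qb′ ∘ proj₁ ∘ proj₂)) o)
      ... | here e         = R⇒¬B e ua
      ... | there (here e) = R⇒¬B e ub
      side : ∀ {u} → Out u → (B u w × B u x) ⊎ (B u y × B u z)
      side o with proj₂ (hits 2 π ((pq ∷ []) ∷ [] ∷ []) tf o)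
      ... | here uw (here (_ , ux)) = inj₁ (uw , ux)
      ... | here uw (there (here (wy , uy))) = ⊥-elim (noCross π px qz o uw wy uy)
      ... | here uw (there (there (here (wz , uz)))) =
        ⊥-elim (noCross (π ▹ (0 ∷ 0 ∷ 0 ∷ 0 ∷ 1 ∷ [])) px qy o uw wz uz)
      ... | there (here ux (here (xy , uy))) =
        ⊥-elim (noCross (π ▹ (0 ∷ 0 ∷ 1 ∷ [])) pw qz o ux xy uy)
      ... | there (here ux (there (here (xz , uz)))) =
        ⊥-elim (noCross (π ▹ (0 ∷ 0 ∷ 1 ∷ 0 ∷ 1 ∷ [])) pw qy o ux xz uz)
      ... | there (there (here uy (here (_ , uz)))) = inj₂ (uy , uz)
      ... | there (there (there (here _ ())))
      cases : ∀ {u} → R u p ⊎ R u q → (B u w × B u x) ⊎ (B u y × B u z) → _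
      cases {u} e (inj₁ (uw , ux)) with R⊎Z {u} {q} (λ uq → noK₄ uq uw ux (qw , qx , wx)) | e
      ... | inj₁ uq | _       = inj₂ (inj₂ (inj₁ (uq , uw , ux)))
      ... | inj₂ zq | inj₁ up = inj₂ (inj₁ ((up , uw , ux) , zq))
      ... | inj₂ zq | inj₂ uq = case trans (sym zq) uq of λ ()
      cases {u} e (inj₂ (uy , uz)) with R⊎Z {u} {p} (λ up → noK₄ up uy uz (py , pz , yz)) | e
      ... | inj₁ up | _       = inj₂ (inj₂ (inj₂ (up , uy , uz)))
      ... | inj₂ zp | inj₂ uq = inj₁ ((uq , uy , uz) , zp)
      ... | inj₂ zp | inj₁ up = case trans (sym zp) up of λ ()

    -- A vertex of B without a red neighbour in A joins A. Otherwise choose for each of the four a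
    -- red neighbour among `p`, `q`: three equal choices give a claw, and two of each kind the
    -- balanced case.
    side₂ : ∀ {p q w x y z} → p ∷ q ∷ w ∷ x ∷ y ∷ z ∷ [] ↭ N → ¬ R p q →
          TriFree (w ∷ x ∷ y ∷ z ∷ []) → Colourable
    side₂ {p} {q} {w} {x} {y} {z} π pq
      tf@(((wxy ∷ wxz ∷ []) ∷ (wyz ∷ []) ∷ [] ∷ []) ∷ ((xyz ∷ []) ∷ [] ∷ []) ∷ _) =
      go (red? w (π ▹ (0 ∷ 0 ∷ 0 ∷ [])) xyz) (red? x (π ▹ (0 ∷ 0 ∷ 1 ∷ [])) wyz)
         (red? y (π ▹ (0 ∷ 0 ∷ 2 ∷ [])) wxz) (red? z (π ▹ (0 ∷ 0 ∷ 3 ∷ [])) wxy)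
      where
      red? : ∀ b {c d e} → p ∷ q ∷ b ∷ c ∷ d ∷ e ∷ [] ↭ N → ¬ Tri c d e →
             Colourable ⊎ (R p b ⊎ R q b)
      red? b π′ t with R? p b | R? q b
      ... | yes e | _ = inj₂ (inj₁ e)
      ... | _ | yes e = inj₂ (inj₂ e)
      ... | no ¬p | no ¬q = inj₁ (side₃ π′ ((pq ∷ ¬p ∷ []) ∷ (¬q ∷ []) ∷ [] ∷ []) t)
      other : ∀ {b} → R p b ⊎ R q b → ¬ Tri p q b
      other (inj₁ e) (_ , b , _) = R⇒¬B e b
      other (inj₂ e) (_ , _ , b) = R⇒¬B e b
      other′ : ∀ {b} → R p b ⊎ R q b → ¬ Tri q p b
      other′ (inj₁ e) (_ , _ , b) = R⇒¬B e b
      other′ (inj₂ e) (_ , b , _) = R⇒¬B e b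
      ⟲ : ∀ {a b c} → Tri a b c → Tri a c b
      ⟲ (ab , ac , bc) = ac , ab , flip bc
      go : Colourable ⊎ (R p w ⊎ R q w) → Colourable ⊎ (R p x ⊎ R q x) →
           Colourable ⊎ (R p y ⊎ R q y) → Colourable ⊎ (R p z ⊎ R q z) → Colourable
      go (inj₁ C) _ _ _ = C
      go _ (inj₁ C) _ _ = C
      go _ _ (inj₁ C) _ = C
      go _ _ _ (inj₁ C) = C
      go (inj₂ (inj₁ pw)) (inj₂ (inj₁ px)) (inj₂ (inj₁ py)) (inj₂ e) =
        claw (π ▹ (2 ∷ 2 ∷ 2 ∷ [])) pw px py (other e)
      go (inj₂ (inj₁ pw)) (inj₂ (inj₁ px)) (inj₂ e@(inj₂ _)) (inj₂ (inj₁ pz)) =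
        claw (π ▹ (2 ∷ 2 ∷ 3 ∷ [])) pw px pz (other e)
      go (inj₂ (inj₁ pw)) (inj₂ e@(inj₂ _)) (inj₂ (inj₁ py)) (inj₂ (inj₁ pz)) =
        claw (π ▹ (2 ∷ 3 ∷ 3 ∷ [])) pw py pz (other e)
      go (inj₂ e@(inj₂ _)) (inj₂ (inj₁ px)) (inj₂ (inj₁ py)) (inj₂ (inj₁ pz)) =
        claw (π ▹ (3 ∷ 3 ∷ 3 ∷ [])) px py pz (other e)
      go (inj₂ (inj₂ qw)) (inj₂ (inj₂ qx)) (inj₂ (inj₂ qy)) (inj₂ e) =
        claw (π ▹ (2 ∷ 2 ∷ 2 ∷ 1 ∷ [])) qw qx qy (other′ e)
      go (inj₂ (inj₂ qw)) (inj₂ (inj₂ qx)) (inj₂ e@(inj₁ _)) (inj₂ (inj₂ qz)) =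
        claw (π ▹ (2 ∷ 2 ∷ 3 ∷ 1 ∷ [])) qw qx qz (other′ e)
      go (inj₂ (inj₂ qw)) (inj₂ e@(inj₁ _)) (inj₂ (inj₂ qy)) (inj₂ (inj₂ qz)) =
        claw (π ▹ (2 ∷ 3 ∷ 3 ∷ 1 ∷ [])) qw qy qz (other′ e)
      go (inj₂ e@(inj₁ _)) (inj₂ (inj₂ qx)) (inj₂ (inj₂ qy)) (inj₂ (inj₂ qz)) =
        claw (π ▹ (3 ∷ 3 ∷ 3 ∷ 1 ∷ [])) qx qy qz (other′ e)
      go (inj₂ (inj₁ pw)) (inj₂ (inj₁ px)) (inj₂ (inj₂ qy)) (inj₂ (inj₂ qz)) =
        balanced π pq tf pw px qy qz
      go (inj₂ (inj₂ qw)) (inj₂ (inj₂ qx)) (inj₂ (inj₁ py)) (inj₂ (inj₁ pz)) =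
        balanced (π ▹ (1 ∷ [])) (pq ∘ flip) tf qw qx py pz
      go (inj₂ (inj₁ pw)) (inj₂ (inj₂ qx)) (inj₂ (inj₁ py)) (inj₂ (inj₂ qz)) =
        balanced (π ▹ (0 ∷ 0 ∷ 0 ∷ 1 ∷ [])) pq
          (triFree₄ (wxy ∘ ⟲) wyz wxz (xyz ∘ λ { (yx , yz , xz) → flip yx , xz , yz })) pw py qx qz
      go (inj₂ (inj₂ qw)) (inj₂ (inj₁ px)) (inj₂ (inj₂ qy)) (inj₂ (inj₁ pz)) =
        balanced (π ▹ (1 ∷ 0 ∷ 0 ∷ 1 ∷ [])) (pq ∘ flip)
          (triFree₄ (wxy ∘ ⟲) wyz wxz (xyz ∘ λ { (yx , yz , xz) → flip yx , xz , yz })) qw qy px pz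
      go (inj₂ (inj₁ pw)) (inj₂ (inj₂ qx)) (inj₂ (inj₂ qy)) (inj₂ (inj₁ pz)) =
        balanced (π ▹ (0 ∷ 0 ∷ 0 ∷ 2 ∷ [])) pq
          (triFree₄ (wxz ∘ ⟲) (wyz ∘ ⟲) wxy (xyz ∘ λ { (zx , zy , xy) → xy , flip zx , flip zy }))
          pw pz qx qy
      go (inj₂ (inj₂ qw)) (inj₂ (inj₁ px)) (inj₂ (inj₁ py)) (inj₂ (inj₂ qz)) =
        balanced (π ▹ (1 ∷ 0 ∷ 0 ∷ 2 ∷ [])) (pq ∘ flip)
          (triFree₄ (wxz ∘ ⟲) (wyz ∘ ⟲) wxy (xyz ∘ λ { (zx , zy , xy) → xy , flip zx , flip zy }))
          qw qz px py

    -- Either some vertex of B can join `a` in A, or `a` is the centre of a red claw.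
    side₁ : ∀ {a v w x y z} → a ∷ v ∷ w ∷ x ∷ y ∷ z ∷ [] ↭ N →
          TriFree (v ∷ w ∷ x ∷ y ∷ z ∷ []) → Colourable
    side₁ {a} {v} {w} {x} {y} {z} π
      (((vwx ∷ vwy ∷ vwz ∷ []) ∷ (vxy ∷ vxz ∷ []) ∷ (vyz ∷ []) ∷ _)
        ∷ tf@(((wxy ∷ wxz ∷ []) ∷ (wyz ∷ []) ∷ _) ∷ ((xyz ∷ []) ∷ _) ∷ _))
      with R? a v | R? a w | R? a x | R? a y
    ... | no ¬av | _ | _ | _ = side₂ π ¬av tf
    ... | _ | no ¬aw | _ | _ = side₂ (π ▹ (0 ∷ 1 ∷ [])) ¬aw (triFree₄ vxy vxz vyz xyz)
    ... | _ | _ | no ¬ax | _ = side₂ (π ▹ (0 ∷ 2 ∷ [])) ¬ax (triFree₄ vwy vwz vyz wyz)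
    ... | _ | _ | _ | no ¬ay = side₂ (π ▹ (0 ∷ 3 ∷ [])) ¬ay (triFree₄ vwx vwz vxz wxz)
    ... | yes av | yes aw | yes ax | yes ay = claw (π ▹ (1 ∷ 1 ∷ 1 ∷ [])) av aw ax (R⇒¬B ay ∘ proj₁)

    -- If A is empty or B has fewer than two vertices, `out₀` cannot have the neighbours that `hits`
    -- promises.
    colourable : ∀ k xs → xs ↭ N → length xs ≡ 6 → RedFree (take k xs) → TriFree (drop k xs) →
                 Colourable
    colourable k (a ∷ b ∷ c ∷ d ∷ e ∷ f ∷ []) π refl = go k
      where
      xs = a ∷ b ∷ c ∷ d ∷ e ∷ f ∷ []
      go : ∀ k → RedFree (take k xs) → TriFree (drop k xs) → Colourable
      go 0 rf tf = case proj₁ (hits 0 π rf tf out₀) of λ ()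
      go 1 rf tf = side₁ π tf
      go 2 ((pq ∷ []) ∷ _) tf = side₂ π pq tf
      go 3 rf (((xyz ∷ []) ∷ _) ∷ _) = side₃ π rf xyz
      go 4 rf tf = side₄ π rf
      go 5 rf tf = case proj₂ (hits 5 π rf tf out₀) of λ { (here _ ()) ; (there ()) }
      go (suc (suc (suc (suc (suc (suc k)))))) rf tf =
        case proj₂ (hits (6 + k) π rf (subst TriFree (sym (drop-[] k)) []) out₀) of
          λ e → case subst (BlueEdge u₀) (drop-[] k) e of λ ()

-- Graphs, recolouring and the lower bound

covering⇒≤ : ∀ {n} (xs : List (Fin n)) → (∀ i → i ∈ xs) → n ≤ length xs
covering⇒≤ xs inside = injective⇒≤ {f = index ∘ inside} λ {i} {j} e →
  trans (Any.lookup-index (inside i))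
    (trans (cong (List.lookup xs) e) (sym (Any.lookup-index (inside j))))

missing : ∀ {n} (xs : List (Fin n)) → length xs < n → ∃ λ i → i ∉ xs
missing {n} xs short with any? (λ i → ¬? (i ∈? xs))
  where open DecMembership (_≟_ {n}) using (_∈?_)
... | yes found = found
... | no ¬found = ⊥-elim (ℕ.<⇒≱ short (covering⇒≤ xs λ i →
                    decidable-stable (i ∈? xs) λ i∉ → ¬found (i , i∉)))
  where open DecMembership (_≟_ {n}) using (_∈?_)

Mono : ∀ {n} → Adjacency n → (Fin n → Fin n → Bool) → Bool → Fin n → Fin n → Set
Mono a c κ x y = x ≢ y × a x y ≡ true × c x y ≡ κ

Triangle : ∀ {A : Set} → (A → A → Set) → A → A → A → Set
Triangle E x y z = E x y × E x z × E y z

module _ {n} {a : Adjacency n} {c : Fin n → Fin n → Bool} {κ : Bool} where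

  monoK₃ : ∀ {x y z} → Triangle (Mono a c κ) x y z → MonoK3 a c κ
  monoK₃ ((p , q , r) , (p′ , q′ , r′) , (p″ , q″ , r″)) =
    _ , _ , _ , (p , p′ , p″) , (q , q′ , q″) , (r , r′ , r″)

  monoK₃⁻¹ : MonoK3 a c κ → ∃₂ λ x y → ∃ λ z → Triangle (Mono a c κ) x y z
  monoK₃⁻¹ (x , y , z , (p , p′ , p″) , (q , q′ , q″) , (r , r′ , r″)) =
    x , y , z , (p , q , r) , (p′ , q′ , r′) , (p″ , q″ , r″)

  monoK₄ : ∀ {w x y z} → Mono a c κ w x → Mono a c κ w y → Mono a c κ w z →
           Triangle (Mono a c κ) x y z → MonoK4 a c κ
  monoK₄ (p₁ , q₁ , r₁) (p₂ , q₂ , r₂) (p₃ , q₃ , r₃)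
         ((p₄ , q₄ , r₄) , (p₅ , q₅ , r₅) , (p₆ , q₆ , r₆)) =
    _ , _ , _ , _ , (p₁ , p₂ , p₃ , p₄ , p₅ , p₆) ,
    (q₁ , q₂ , q₃ , q₄ , q₅ , q₆) , (r₁ , r₂ , r₃ , r₄ , r₅ , r₆)

  monoK₄⁻¹ : MonoK4 a c κ → ∃₂ λ w x → ∃₂ λ y z →
             (Mono a c κ w x × Mono a c κ w y × Mono a c κ w z) × Triangle (Mono a c κ) x y z
  monoK₄⁻¹ (w , x , y , z , (p₁ , p₂ , p₃ , p₄ , p₅ , p₆) ,
            (q₁ , q₂ , q₃ , q₄ , q₅ , q₆) , (r₁ , r₂ , r₃ , r₄ , r₅ , r₆)) =
    w , x , y , z , ((p₁ , q₁ , r₁) , (p₂ , q₂ , r₂) , (p₃ , q₃ , r₃)) ,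
    (p₄ , q₄ , r₄) , (p₅ , q₅ , r₅) , (p₆ , q₆ , r₆)

Good : ∀ {n} → Adjacency n → (Fin n → Fin n → Bool) → Set
Good a c = ¬ MonoK3 a c Red × ¬ MonoK4 a c Blue

monoK3? : ∀ {n} (a : Adjacency n) c κ → Dec (MonoK3 a c κ)
monoK3? a c κ = any? λ x → any? λ y → any? λ z →
  (¬? (x ≟ y) ×-dec ¬? (x ≟ z) ×-dec ¬? (y ≟ z)) ×-dec
  (a x y Bool.≟ true ×-dec a x z Bool.≟ true ×-dec a y z Bool.≟ true) ×-dec
  (c x y Bool.≟ κ ×-dec c x z Bool.≟ κ ×-dec c y z Bool.≟ κ)

monoK4? : ∀ {n} (a : Adjacency n) c κ → Dec (MonoK4 a c κ)
monoK4? a c κ = any? λ w → any? λ x → any? λ y → any? λ z →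
  (¬? (w ≟ x) ×-dec ¬? (w ≟ y) ×-dec ¬? (w ≟ z) ×-dec
   ¬? (x ≟ y) ×-dec ¬? (x ≟ z) ×-dec ¬? (y ≟ z)) ×-dec
  (a w x Bool.≟ true ×-dec a w y Bool.≟ true ×-dec a w z Bool.≟ true ×-dec
   a x y Bool.≟ true ×-dec a x z Bool.≟ true ×-dec a y z Bool.≟ true) ×-dec
  (c w x Bool.≟ κ ×-dec c w y Bool.≟ κ ×-dec c w z Bool.≟ κ ×-dec
   c x y Bool.≟ κ ×-dec c x z Bool.≟ κ ×-dec c y z Bool.≟ κ)

-- A graph that does not arrow provides no good colouring constructively. This contrapositive
-- suffices to refute it, because monochromatic cliques can be searched for.
allBad⇒arrows : ∀ {n} {a : Adjacency n} →
                (∀ c → (∀ x y → c x y ≡ c y x) → ¬ Good a c) → ArrowsK3K4 a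
allBad⇒arrows {a = a} bad c c-sym with monoK3? a c Red | monoK4? a c Blue
... | yes t | _     = inj₁ t
... | no _  | yes k = inj₂ k
... | no ¬t | no ¬k = ⊥-elim (bad c c-sym (¬t , ¬k))

-- The Möbius ladder on eight vertices: a critical colouring for R(3,4) = 9.
ladder : Fin 8 → Fin 8 → Bool
ladder i j = isRed ∣ toℕ i - toℕ j ∣
  where
  isRed : ℕ → Bool
  isRed 1 = true
  isRed 4 = true
  isRed 7 = true
  isRed _ = false

ladder-sym : ∀ i j → ladder i j ≡ ladder j i
ladder-sym i j rewrite ℕ.∣-∣-comm (toℕ i) (toℕ j) = refl

complete : ∀ {n} → Adjacency n
complete _ _ = true

ladder-good : Good complete ladder
ladder-good = toWitnessFalse {a? = monoK3? _ ladder Red} _ ,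
              toWitnessFalse {a? = monoK4? _ ladder Blue} _

-- Adjacent vertices have distinct images, so a monochromatic clique of the pulled-back colouring
-- maps to one of the same colour in K₈.
eightColourable⇒¬arrows : ∀ {n} {a : Adjacency n} (f : Fin n → Fin 8) →
                          (∀ {x y} → a x y ≡ true → f x ≢ f y) → ¬ ArrowsK3K4 a
eightColourable⇒¬arrows {a = a} f proper arrows
  with arrows (λ x y → ladder (f x) (f y)) (λ x y → ladder-sym (f x) (f y))
... | inj₁ t with _ , _ , _ , xy , xz , yz ← monoK₃⁻¹ t =
  proj₁ ladder-good (monoK₃ (push xy , push xz , push yz))
  where
  push : ∀ {κ x y} → Mono a (λ x y → ladder (f x) (f y)) κ x y → Mono complete ladder κ (f x) (f y)
  push (_ , adj , e) = proper adj , refl , e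
... | inj₂ k with _ , _ , _ , _ , (wx , wy , wz) , xy , xz , yz ← monoK₄⁻¹ k =
  proj₂ ladder-good (monoK₄ (push wx) (push wy) (push wz) (push xy , push xz , push yz))
  where
  push : ∀ {κ x y} → Mono a (λ x y → ladder (f x) (f y)) κ x y → Mono complete ladder κ (f x) (f y)
  push (_ , adj , e) = proper adj , refl , e

addEdge-old : ∀ {n} {a : Adjacency n} {u v x y} → a x y ≡ true → addEdge a u v x y ≡ true
addEdge-old e rewrite e = refl

addEdge-new : ∀ {n} {a : Adjacency n} {u v x y} → (x ≡ u × y ≡ v) ⊎ (x ≡ v × y ≡ u) →
              addEdge a u v x y ≡ true
addEdge-new {a = a} {u} {v} (inj₁ (refl , refl))
  rewrite dec-true (u ≟ u) refl | dec-true (v ≟ v) refl = ∨-zeroʳ (a u v)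
addEdge-new {a = a} {u} {v} (inj₂ (refl , refl))
  rewrite dec-true (u ≟ u) refl | dec-true (v ≟ v) refl
        | ∨-zeroʳ (does (v ≟ u) ∧ does (u ≟ v)) = ∨-zeroʳ (a v u)

addEdge⁻¹ : ∀ {n} {a : Adjacency n} {u v x y} → addEdge a u v x y ≡ true →
            a x y ≡ true ⊎ (x ≡ u × y ≡ v) ⊎ (x ≡ v × y ≡ u)
addEdge⁻¹ {a = a} {u} {v} {x} {y} e with a x y | x ≟ u | y ≟ v | x ≟ v | y ≟ u
... | true  | _       | _       | _       | _       = inj₁ refl
... | false | yes x≡u | yes y≡v | _       | _       = inj₂ (inj₁ (x≡u , y≡v))
... | false | _       | _       | yes x≡v | yes y≡u = inj₂ (inj₂ (x≡v , y≡u))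
... | false | yes _   | no _    | yes _   | no _    = case e of λ ()
... | false | yes _   | no _    | no _    | _       = case e of λ ()
... | false | no _    | _       | yes _   | no _    = case e of λ ()
... | false | no _    | _       | no _    | _       = case e of λ ()

module _ {A : Set} {E : A → A → Set} (E-sym : ∀ {x y} → E x y → E y x)
         (_≟ᴬ_ : ∀ (x y : A) → Dec (x ≡ y)) (v : A) where

  -- By symmetry a clique through `v` can be listed with `v` first, so later arguments treat one
  -- position only.
  pivot₃ : ∀ {x y z} → Triangle E x y z →
           (x ≢ v × y ≢ v × z ≢ v) ⊎ ∃₂ (Triangle E v)
  pivot₃ {x} {y} {z} (xy , xz , yz) with x ≟ᴬ v | y ≟ᴬ v | z ≟ᴬ v
  ... | yes refl | _ | _ = inj₂ (_ , _ , xy , xz , yz)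
  ... | _ | yes refl | _ = inj₂ (_ , _ , E-sym xy , yz , xz)
  ... | _ | _ | yes refl = inj₂ (_ , _ , E-sym xz , E-sym yz , xy)
  ... | no x≢v | no y≢v | no z≢v = inj₁ (x≢v , y≢v , z≢v)

  pivot₄ : ∀ {w x y z} → E w x × E w y × E w z → Triangle E x y z →
           (w ≢ v × x ≢ v × y ≢ v × z ≢ v) ⊎
           ∃₂ λ x y → ∃ λ z → (E v x × E v y × E v z) × Triangle E x y z
  pivot₄ {w} {x} {y} {z} (wx , wy , wz) t@(xy , xz , yz) with w ≟ᴬ v | x ≟ᴬ v | y ≟ᴬ v | z ≟ᴬ v
  ... | yes refl | _ | _ | _ = inj₂ (_ , _ , _ , (wx , wy , wz) , t)
  ... | _ | yes refl | _ | _ = inj₂ (_ , _ , _ , (E-sym wx , xy , xz) , wy , wz , yz)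
  ... | _ | _ | yes refl | _ = inj₂ (_ , _ , _ , (E-sym wy , E-sym xy , yz) , wx , wz , xz)
  ... | _ | _ | _ | yes refl = inj₂ (_ , _ , _ , (E-sym wz , E-sym xz , E-sym yz) , wx , wy , xy)
  ... | no w≢v | no x≢v | no y≢v | no z≢v = inj₁ (w≢v , x≢v , y≢v , z≢v)

take-length : ∀ {A : Set} (xs ys : List A) → take (length xs) (xs ++ ys) ≡ xs
take-length []       ys = refl
take-length (x ∷ xs) ys = cong (x ∷_) (take-length xs ys)

drop-length : ∀ {A : Set} (xs ys : List A) → drop (length xs) (xs ++ ys) ≡ ys
drop-length []       ys = refl
drop-length (x ∷ xs) ys = drop-length xs ys

allPairs-∈ : ∀ {A : Set} {P : A → A → Set} xs → (∀ {x y} → x ∈ xs → y ∈ xs → P x y) →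
             AllPairs P xs
allPairs-∈ []       p = []
allPairs-∈ (x ∷ xs) p =
  All.tabulate (λ i → p (here refl) (there i)) ∷ allPairs-∈ xs λ i j → p (there i) (there j)

length-filter-split : ∀ {A : Set} (p : A → Bool) xs →
  length (filter (λ x → p x Bool.≟ true) xs) + length (filter (λ x → p x Bool.≟ false) xs) ≡ length xs
length-filter-split p []       = refl
length-filter-split p (x ∷ xs) with p x
... | true  = cong suc (length-filter-split p xs)
... | false = trans (ℕ.+-suc _ _) (cong suc (length-filter-split p xs))

sum-indicator : ∀ {A : Set} (p : A → Bool) xs →
  sum (map (λ x → if p x then 1 else 0) xs) ≡ length (filter (λ x → p x Bool.≟ true) xs)
sum-indicator p []       = refl
sum-indicator p (x ∷ xs) with p x
... | true  = cong suc (sum-indicator p xs)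
... | false = sum-indicator p xs

-- A vertex of degree at most six in a saturated graph

module LowDegree {n} (G : Graph n) (v : Fin n)
  (saturated : ∀ u → u ≢ v → adj G v u ≡ false → ArrowsK3K4 (addEdge (adj G) v u))
  (large : 9 ≤ n) (low : degree G v ≤ 6)
  (c : Fin n → Fin n → Bool) (c-sym : ∀ x y → c x y ≡ c y x) (good : Good (adj G) c)
  where

  open DecMembership (_≟_ {n}) using (_∈?_)

  shade : Bool → Bool → Bool → Colour
  shade true  _     _     = none
  shade false false _     = none
  shade false true  true  = red
  shade false true  false = blue

  atV : Fin n → Bool
  atV x = does (x ≟ v)

  atV-false : ∀ {x} → x ≢ v → atV x ≡ false
  atV-false {x} = dec-false (x ≟ v)

  atV-false⁻¹ : ∀ {x} → atV x ≡ false → x ≢ v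
  atV-false⁻¹ e refl = case trans (sym (dec-true (v ≟ v) refl)) e of λ ()

  -- H is kept on the vertex set of G, with `v` isolated rather than removed.
  col : Fin n → Fin n → Colour
  col x y = shade (atV x ∨ atV y) (adj G x y) (c x y)

  col-sym : ∀ x y → col x y ≡ col y x
  col-sym x y rewrite ∨-comm (atV x) (atV y) | Graph.sym G x y | c-sym x y = refl

  col-irr : ∀ x → col x x ≡ none
  col-irr x rewrite Graph.irrefl G x with atV x ∨ atV x
  ... | true  = refl
  ... | false = refl

  adj⇒≢ : ∀ {x y} → adj G x y ≡ true → x ≢ y
  adj⇒≢ {x} e refl = case trans (sym (Graph.irrefl G x)) e of λ ()

  shade-red : ∀ {r a k} → shade r a k ≡ red → a ≡ true × k ≡ true
  shade-red {false} {true} {true} _ = refl , refl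

  shade-blue : ∀ {r a k} → shade r a k ≡ blue → a ≡ true × k ≡ false
  shade-blue {false} {true} {false} _ = refl , refl

  red⇒mono : ∀ {x y} → col x y ≡ red → Mono (adj G) c Red x y
  red⇒mono {x} {y} e with a , k ← shade-red {atV x ∨ atV y} e = adj⇒≢ a , a , k

  blue⇒mono : ∀ {x y} → col x y ≡ blue → Mono (adj G) c Blue x y
  blue⇒mono {x} {y} e with a , k ← shade-blue {atV x ∨ atV y} e = adj⇒≢ a , a , k

  mono⇒red : ∀ {x y} → x ≢ v → y ≢ v → Mono (adj G) c Red x y → col x y ≡ red
  mono⇒red x≢v y≢v (_ , a , k) rewrite atV-false x≢v | atV-false y≢v | a | k = refl

  mono⇒blue : ∀ {x y} → x ≢ v → y ≢ v → Mono (adj G) c Blue x y → col x y ≡ blue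
  mono⇒blue x≢v y≢v (_ , a , k) rewrite atV-false x≢v | atV-false y≢v | a | k = refl

  v-isolated : ∀ y → col v y ≡ none
  v-isolated y rewrite dec-true (v ≟ v) refl = refl

  open ColouredGraph col col-sym col-irr
    (λ xy xz yz → proj₁ good (monoK₃ (red⇒mono xy , red⇒mono xz , red⇒mono yz)))
    (λ wx wy wz (xy , xz , yz) → proj₂ good (monoK₄ (blue⇒mono wx) (blue⇒mono wy) (blue⇒mono wz)
                                   (blue⇒mono xy , blue⇒mono xz , blue⇒mono yz)))

  redFree-∈ : ∀ {xs x y} → RedFree xs → x ∈ xs → y ∈ xs → ¬ R x y
  redFree-∈ (_ ∷ _)  (here refl) (here refl) r = case trans (sym r) (col-irr _) of λ ()
  redFree-∈ (h ∷ _)  (here refl) (there j)   r = All.lookup h j r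
  redFree-∈ (h ∷ _)  (there i)   (here refl) r = All.lookup h i (flip r)
  redFree-∈ (_ ∷ rf) (there i)   (there j)   r = redFree-∈ rf i j r

  allPairs-lookup : ∀ {P : Fin n → Fin n → Set} {xs x y} → (∀ {x y} → P x y → P y x) →
                    AllPairs P xs → x ∈ xs → y ∈ xs → x ≢ y → P x y
  allPairs-lookup s (_ ∷ _)  (here refl) (here refl) ne = ⊥-elim (ne refl)
  allPairs-lookup s (h ∷ _)  (here refl) (there j)   ne = All.lookup h j
  allPairs-lookup s (h ∷ _)  (there i)   (here refl) ne = s (All.lookup h i)
  allPairs-lookup s (_ ∷ ps) (there i)   (there j)   ne = allPairs-lookup s ps i j ne

  B⇒≢ : ∀ {x y} → B x y → x ≢ y
  B⇒≢ b refl = case trans (sym b) (col-irr _) of λ ()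

  triFree-∈ : ∀ {xs x y z} → TriFree xs → x ∈ xs → y ∈ xs → z ∈ xs → ¬ Tri x y z
  triFree-∈ (_ ∷ _) (here refl) (here refl) _ (b , _ , _) = B⇒≢ b refl
  triFree-∈ (_ ∷ _) (here refl) _ (here refl) (_ , b , _) = B⇒≢ b refl
  triFree-∈ (_ ∷ _) _ (here refl) (here refl) (_ , _ , b) = B⇒≢ b refl
  triFree-∈ (h ∷ _) (here refl) (there j) (there k) t@(_ , _ , b) =
    allPairs-lookup (λ ¬t (xz , xy , zy) → ¬t (xy , xz , flip zy)) h j k (B⇒≢ b) t
  triFree-∈ (h ∷ _) (there i) (here refl) (there k) (xy , xz , yz) =
    allPairs-lookup (λ ¬t (xz , xy , zy) → ¬t (xy , xz , flip zy)) h i k (B⇒≢ xz) (flip xy , yz , xz)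
  triFree-∈ (h ∷ _) (there i) (there j) (here refl) (xy , xz , yz) =
    allPairs-lookup (λ ¬t (xz , xy , zy) → ¬t (xy , xz , flip zy)) h i j (B⇒≢ xy) (flip xz , flip yz , xy)
  triFree-∈ (_ ∷ tf) (there i) (there j) (there k) t = triFree-∈ tf i j k t

  triFree-intro : ∀ xs → (∀ {x y z} → x ∈ xs → y ∈ xs → z ∈ xs → ¬ Tri x y z) → TriFree xs
  triFree-intro []       ¬t = []
  triFree-intro (x ∷ xs) ¬t =
    allPairs-∈ xs (λ i j → ¬t (here refl) (there i) (there j))
    ∷ triFree-intro xs λ i j k → ¬t (there i) (there j) (there k)

  blueEdge-intro : ∀ {u xs x y} → x ∈ xs → y ∈ xs → B x y → B u x → B u y → BlueEdge u xs
  blueEdge-intro (here refl) (here refl) xy _ _ = ⊥-elim (B⇒≢ xy refl)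
  blueEdge-intro {u} (here refl) (there j) xy ux uy =
    here ux (Any.map (λ { refl → xy , uy }) j)
  blueEdge-intro (there i) (here refl) xy ux uy =
    here uy (Any.map (λ { refl → flip xy , ux }) i)
  blueEdge-intro (there i) (there j) xy ux uy = there (blueEdge-intro i j xy ux uy)

  Out : Fin n → Set
  Out u = u ≢ v × adj G v u ≡ false

  -- Tests one partition of the neighbourhood against saturation: the edges at `v` become red
  -- towards `as` and blue towards `bs`, and the new edge `vu` receives the colour `d`.
  module Recolour {u} (out : Out u) (as bs : List (Fin n))
    (neighbours : ∀ {x} → adj G v x ≡ true → x ∈ as ⊎ x ∈ bs)
    (rf : RedFree as) (tf : TriFree bs) (d : Bool) where

    spoke : Fin n → Bool
    spoke y = if does (y ≟ u) then d else does (y ∈? as)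

    c′ : Fin n → Fin n → Bool
    c′ x y = if atV x then spoke y else if atV y then spoke x else c x y

    c′-sym : ∀ x y → c′ x y ≡ c′ y x
    c′-sym x y with x ≟ v | y ≟ v
    ... | yes refl | yes refl = refl
    ... | yes _    | no _     = refl
    ... | no _     | yes _    = refl
    ... | no _     | no _     = c-sym x y

    E : Bool → Fin n → Fin n → Set
    E = Mono (addEdge (adj G) v u) c′

    E-sym : ∀ {κ x y} → E κ x y → E κ y x
    E-sym {x = x} {y} (x≢y , a , k) = x≢y ∘ sym , a′ (addEdge⁻¹ {a = adj G} a) , trans (c′-sym y x) k
      where
      a′ : adj G x y ≡ true ⊎ (x ≡ v × y ≡ u) ⊎ (x ≡ u × y ≡ v) → addEdge (adj G) v u y x ≡ true
      a′ (inj₁ e) = addEdge-old {a = adj G} (trans (Graph.sym G y x) e)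
      a′ (inj₂ (inj₁ (p , q))) = addEdge-new {a = adj G} (inj₂ (q , p))
      a′ (inj₂ (inj₂ (p , q))) = addEdge-new {a = adj G} (inj₁ (q , p))

    away : ∀ {κ x y} → x ≢ v → y ≢ v → E κ x y → Mono (adj G) c κ x y
    away {x = x} {y} x≢v y≢v (x≢y , a , k) with addEdge⁻¹ {a = adj G} a
    ... | inj₁ e rewrite atV-false x≢v | atV-false y≢v = x≢y , e , k
    ... | inj₂ (inj₁ (x≡v , _)) = ⊥-elim (x≢v x≡v)
    ... | inj₂ (inj₂ (_ , y≡v)) = ⊥-elim (y≢v y≡v)

    E⇒≢v : ∀ {κ y} → E κ v y → y ≢ v
    E⇒≢v (v≢y , _) e = v≢y (sym e)

    c′-v : ∀ y → c′ v y ≡ spoke y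
    c′-v y rewrite dec-true (v ≟ v) refl = refl

    at-v : ∀ {κ y} → E κ v y → (y ≡ u × d ≡ κ) ⊎ (adj G v y ≡ true × does (y ∈? as) ≡ κ)
    at-v {κ} {y} (v≢y , a , k) = go (addEdge⁻¹ {a = adj G} a) (trans (sym (c′-v y)) k)
      where
      go : adj G v y ≡ true ⊎ (v ≡ v × y ≡ u) ⊎ (v ≡ u × y ≡ v) → spoke y ≡ κ → _
      go e k with y ≟ u | e
      ... | yes y≡u | _ = inj₁ (y≡u , k)
      ... | no y≢u | inj₁ e = inj₂ (e , k)
      ... | no y≢u | inj₂ (inj₁ (_ , y≡u)) = ⊥-elim (y≢u y≡u)
      ... | no y≢u | inj₂ (inj₂ (_ , y≡v)) = ⊥-elim (v≢y (sym y≡v))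

    red-v : ∀ {y} → E Red v y → (y ≡ u × d ≡ Red) ⊎ y ∈ as
    red-v {y} e with at-v e
    ... | inj₁ p = inj₁ p
    ... | inj₂ (_ , k) with y ∈? as
    ...   | yes i = inj₂ i
    ...   | no _  = case k of λ ()

    blue-v : ∀ {y} → E Blue v y → (y ≡ u × d ≡ Blue) ⊎ y ∈ bs
    blue-v {y} e with at-v e
    ... | inj₁ p = inj₁ p
    ... | inj₂ (a , k) with y ∈? as | neighbours a
    ...   | yes _ | _      = case k of λ ()
    ...   | no ∉  | inj₁ i = ⊥-elim (∉ i)
    ...   | no _  | inj₂ i = inj₂ i

    -- The forced clique passes through `v`, since `c` is good elsewhere, and through `u`, since
    -- `as` has no red edge and `bs` no blue triangle. So it uses the new edge and has colour `d`.
    outcome : (d ≡ Red × Any (R u) as) ⊎ (d ≡ Blue × BlueEdge u bs)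
    outcome with saturated u (proj₁ out) (proj₂ out) c′ c′-sym
    outcome | inj₁ t with _ , _ , _ , t′ ← monoK₃⁻¹ t with pivot₃ E-sym _≟_ v t′
    ... | inj₁ (x≢v , y≢v , z≢v) with xy , xz , yz ← t′ =
      ⊥-elim (proj₁ good (monoK₃ (away x≢v y≢v xy , away x≢v z≢v xz , away y≢v z≢v yz)))
    ... | inj₂ (y , z , vy , vz , yz) with red-v vy | red-v vz
          | mono⇒red (E⇒≢v vy) (E⇒≢v vz) (away (E⇒≢v vy) (E⇒≢v vz) yz)
    ...   | inj₁ (refl , _) | inj₁ (refl , _) | _  = ⊥-elim (proj₁ yz refl)
    ...   | inj₁ (refl , e) | inj₂ i          | r  = inj₁ (e , Any.map (λ { refl → r }) i)
    ...   | inj₂ i          | inj₁ (refl , e) | r  = inj₁ (e , Any.map (λ { refl → flip r }) i)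
    ...   | inj₂ i          | inj₂ j          | r  = ⊥-elim (redFree-∈ rf i j r)
    outcome | inj₂ k with _ , _ , _ , _ , s , t ← monoK₄⁻¹ k with pivot₄ E-sym _≟_ v s t
    ... | inj₁ (w≢v , x≢v , y≢v , z≢v) with wx , wy , wz ← s with xy , xz , yz ← t =
      ⊥-elim (proj₂ good (monoK₄ (away w≢v x≢v wx) (away w≢v y≢v wy) (away w≢v z≢v wz)
                            (away x≢v y≢v xy , away x≢v z≢v xz , away y≢v z≢v yz)))
    ... | inj₂ (x , y , z , (vx , vy , vz) , xy , xz , yz)
      with blue-v vx | blue-v vy | blue-v vz
          | inner vx vy xy | inner vx vz xz | inner vy vz yz
      where
      inner : ∀ {x y} → E Blue v x → E Blue v y → E Blue x y → B x y
      inner vx vy xy = mono⇒blue (E⇒≢v vx) (E⇒≢v vy) (away (E⇒≢v vx) (E⇒≢v vy) xy)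
    ...   | inj₂ i | inj₂ j | inj₂ k | p | q | r = ⊥-elim (triFree-∈ tf i j k (p , q , r))
    ...   | inj₁ (refl , e) | inj₂ j | inj₂ k | p | q | r = inj₂ (e , blueEdge-intro j k r p q)
    ...   | inj₂ i | inj₁ (refl , e) | inj₂ k | p | q | r = inj₂ (e , blueEdge-intro i k q (flip p) r)
    ...   | inj₂ i | inj₂ j | inj₁ (refl , e) | p | q | r =
      inj₂ (e , blueEdge-intro i j p (flip q) (flip r))
    ...   | inj₁ (refl , _) | inj₁ (refl , _) | _ | p | _ | _ = ⊥-elim (B⇒≢ p refl)
    ...   | inj₁ (refl , _) | _ | inj₁ (refl , _) | _ | q | _ = ⊥-elim (B⇒≢ q refl)
    ...   | _ | inj₁ (refl , _) | inj₁ (refl , _) | _ | _ | r = ⊥-elim (B⇒≢ r refl)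

  nbrs reds blues N : List (Fin n)
  nbrs  = filter (λ x → adj G v x Bool.≟ true) (allFin n)
  reds  = filter (λ x → c v x Bool.≟ true) nbrs
  blues = filter (λ x → c v x Bool.≟ false) nbrs
  -- Padded with v, which is isolated in col, to have exactly six entries.
  N = reds ++ blues ++ replicate (6 ∸ length nbrs) v

  nbrs≤6 : length nbrs ≤ 6
  nbrs≤6 = subst (_≤ 6) (sum-indicator (adj G v) (allFin n)) low

  nbr∈ : ∀ {x} → adj G v x ≡ true → x ∈ nbrs
  nbr∈ {x} = ∈-filter⁺ (λ x → adj G v x Bool.≟ true) (∈-allFin x)

  nbr∈N : ∀ {x} → adj G v x ≡ true → x ∈ N
  nbr∈N {x} a with c v x in k
  ... | true  = ∈-++⁺ˡ (∈-filter⁺ (λ x → c v x Bool.≟ true) (nbr∈ a) k)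
  ... | false = ∈-++⁺ʳ reds (∈-++⁺ˡ (∈-filter⁺ (λ x → c v x Bool.≟ false) (nbr∈ a) k))

  length-N : length N ≡ 6
  length-N rewrite length-++ reds {blues ++ replicate (6 ∸ length nbrs) v}
    | length-++ blues {replicate (6 ∸ length nbrs) v} | length-replicate (6 ∸ length nbrs) {v}
    | sym (ℕ.+-assoc (length reds) (length blues) (6 ∸ length nbrs))
    | length-filter-split (c v) nbrs = ℕ.m+[n∸m]≡n nbrs≤6

  ∈reds⇒mono : ∀ {x} → x ∈ reds → Mono (adj G) c Red v x
  ∈reds⇒mono i with j , k ← ∈-filter⁻ (λ x → c v x Bool.≟ true) i
    with _ , a ← ∈-filter⁻ (λ x → adj G v x Bool.≟ true) {xs = allFin n} j = adj⇒≢ a , a , k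

  ∈blues⇒mono : ∀ {x} → x ∈ blues → Mono (adj G) c Blue v x
  ∈blues⇒mono i with j , k ← ∈-filter⁻ (λ x → c v x Bool.≟ false) i
    with _ , a ← ∈-filter⁻ (λ x → adj G v x Bool.≟ true) {xs = allFin n} j = adj⇒≢ a , a , k

  reds-redFree : RedFree reds
  reds-redFree = allPairs-∈ reds λ i j r →
    proj₁ good (monoK₃ (∈reds⇒mono i , ∈reds⇒mono j , red⇒mono r))

  blues-triFree : TriFree (blues ++ replicate (6 ∸ length nbrs) v)
  blues-triFree = triFree-intro _ λ i j k (xy , xz , yz) →
    proj₂ good (monoK₄ (joined i xy) (joined j yz) (joined k (flip xz))
                 (blue⇒mono xy , blue⇒mono xz , blue⇒mono yz))
    where
    joined : ∀ {x y} → x ∈ blues ++ replicate (6 ∸ length nbrs) v → B x y → Mono (adj G) c Blue v x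
    joined {y = y} i b with ∈-++⁻ blues i
    ... | inj₁ j = ∈blues⇒mono j
    -- A padding entry is `v`, which lies on no blue edge of `col`.
    ... | inj₂ j with refl ← All.lookup (All.replicate⁺ {P = v ≡_} (6 ∸ length nbrs) refl) j =
      case trans (sym b) (v-isolated y) of λ ()

  someOut : ∃ Out
  someOut with u , u∉ ← missing (v ∷ nbrs) (ℕ.≤-trans (s≤s (s≤s nbrs≤6)) (ℕ.≤-trans (ℕ.n≤1+n 8) large)) =
    u , u∉ ∘ here , ¬-not (u∉ ∘ there ∘ nbr∈)

  cover : ∀ x → x ∈ N ⊎ Out x ⊎ (∀ y → Z x y)
  cover x with x ≟ v | adj G v x Bool.≟ true
  ... | yes refl | _     = inj₂ (inj₂ λ _ → refl)
  ... | no _     | yes a = inj₁ (nbr∈N a)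
  ... | no x≢v   | no ¬a = inj₂ (inj₁ (x≢v , ¬-not ¬a))

  -- The partition is tested twice: a red new edge yields the red neighbour, a blue one the blue
  -- edge.
  hits : ∀ k {xs} → xs ↭ N → RedFree (take k xs) → TriFree (drop k xs) →
         ∀ {u} → Out u → Any (R u) (take k xs) × BlueEdge u (drop k xs)
  hits k {xs} π rf tf out = fromRed (outcome Red) , fromBlue (outcome Blue)
    where
    open Recolour out (take k xs) (drop k xs)
      (λ {x} a → ∈-++⁻ (take k xs) (subst (x ∈_) (sym (take++drop≡id k xs))
                                     (∈-resp-↭ (↭-sym π) (nbr∈N a)))) rf tf
    fromRed : ∀ {P Q : Set} → (Red ≡ Red × P) ⊎ (Red ≡ Blue × Q) → P
    fromRed (inj₁ (_ , p)) = p
    fromBlue : ∀ {P Q : Set} → (Blue ≡ Red × P) ⊎ (Blue ≡ Blue × Q) → Q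
    fromBlue (inj₂ (_ , q)) = q

  absurd : ⊥
  absurd with u , out ← someOut
    -- The initial partition is the one that `c` itself induces at `v`.
    with f , proper ← Critical.colourable N Out cover out hits (length reds) N ↭-refl length-N
           (subst RedFree (sym (take-length reds _)) reds-redFree)
           (subst TriFree (sym (drop-length reds _)) blues-triFree)
    -- At most seven colours occur on `u` and the neighbours of `v`; the missing eighth is given to
    -- `v`, so that G + vu is 8-colourable.
    with k , k∉ ← missing (f u ∷ map f nbrs)
           (s≤s (ℕ.≤-trans (s≤s (ℕ.≤-reflexive (length-map f nbrs))) (s≤s nbrs≤6))) =
    eightColourable⇒¬arrows g proper′ (saturated u (proj₁ out) (proj₂ out))
    where
    g : Fin n → Fin 8
    g x = if atV x then k else f x
    fromV : ∀ {y} → adj G v y ≡ true ⊎ y ≡ u → k ≢ f y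
    fromV (inj₁ a)    refl = k∉ (there (∈-map⁺ f (nbr∈ a)))
    fromV (inj₂ refl) refl = k∉ (here refl)
    adjacent : ∀ {x y} → x ≢ v → y ≢ v → adj G x y ≡ true → ¬ Z x y
    adjacent {x} {y} x≢v y≢v a z = go (c x y) refl
      where
      go : ∀ κ → c x y ≡ κ → ⊥
      go true  e = case trans (sym z) (mono⇒red x≢v y≢v (adj⇒≢ a , a , e)) of λ ()
      go false e = case trans (sym z) (mono⇒blue x≢v y≢v (adj⇒≢ a , a , e)) of λ ()
    edge : ∀ {x y} → adj G x y ≡ true ⊎ (x ≡ v × y ≡ u) ⊎ (x ≡ u × y ≡ v) → g x ≢ g y
    edge {x} {y} e with x ≟ v | y ≟ v | e
    ... | yes refl | yes refl | inj₁ a                 = λ _ → adj⇒≢ a refl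
    ... | yes refl | yes refl | inj₂ (inj₁ (_ , v≡u))  = λ _ → proj₁ out (sym v≡u)
    ... | yes refl | yes refl | inj₂ (inj₂ (v≡u , _))  = λ _ → proj₁ out (sym v≡u)
    ... | yes refl | no _     | inj₁ a                 = fromV (inj₁ a)
    ... | yes refl | no _     | inj₂ (inj₁ (_ , y≡u))  = fromV (inj₂ y≡u)
    ... | yes refl | no y≢v   | inj₂ (inj₂ (_ , y≡v))  = ⊥-elim (y≢v y≡v)
    ... | no _     | yes refl | inj₁ a                 = fromV (inj₁ (trans (Graph.sym G v x) a)) ∘ sym
    ... | no x≢v   | yes refl | inj₂ (inj₁ (x≡v , _))  = ⊥-elim (x≢v x≡v)
    ... | no _     | yes refl | inj₂ (inj₂ (x≡u , _))  = fromV (inj₂ x≡u) ∘ sym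
    ... | no x≢v   | no y≢v   | inj₁ a                 = proper (adjacent x≢v y≢v a)
    ... | no x≢v   | no _     | inj₂ (inj₁ (x≡v , _))  = ⊥-elim (x≢v x≡v)
    ... | no _     | no y≢v   | inj₂ (inj₂ (_ , y≡v))  = ⊥-elim (y≢v y≡v)
    proper′ : ∀ {x y} → addEdge (adj G) v u x y ≡ true → g x ≢ g y
    proper′ a = edge (addEdge⁻¹ {a = adj G} a)

minDegree≥7 : ∀ n → 9 ≤ n → (G : Graph n) → CoCriticalK3K4 G → MinDegree≥ G 7
minDegree≥7 n large G (_ , ¬arrows , saturated) v with 7 ℕ.≤? degree G v
... | yes p = p
... | no ¬p = ⊥-elim (¬arrows (allBad⇒arrows λ c c-sym good →
  LowDegree.absurd G v (λ u u≢v → saturated v u (u≢v ∘ sym)) large (ℕ.≤-pred (ℕ.≰⇒> ¬p)) c c-sym good))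

-- R(3,4) ≤ 9 and the extremal graphs

sum-map-+ : ∀ {A : Set} (f g : A → ℕ) xs →
            sum (map (λ x → f x + g x) xs) ≡ sum (map f xs) + sum (map g xs)
sum-map-+ f g []       = refl
sum-map-+ f g (x ∷ xs) rewrite sum-map-+ f g xs = interchange (f x) (g x) _ _
  where
  interchange : ∀ a b c d → (a + b) + (c + d) ≡ (a + c) + (b + d)
  interchange a b c d rewrite ℕ.+-assoc a b (c + d) | ℕ.+-assoc a c (b + d)
    | sym (ℕ.+-assoc b c d) | ℕ.+-comm b c | ℕ.+-assoc c b d = refl

sum-const : ∀ {A : Set} (f : A → ℕ) k {xs} → All (λ x → f x ≡ k) xs → sum (map f xs) ≡ length xs * k
sum-const f k []       = refl
sum-const f k (e ∷ es) = cong₂ _+_ e (sum-const f k es)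

-- Splitting off `x` removes a row and a column with equal sums and a zero diagonal entry.
handshake : ∀ {A : Set} (f : A → A → ℕ) → (∀ x y → f x y ≡ f y x) → (∀ x → f x x ≡ 0) →
            ∀ xs → 2 ∣ sum (map (λ x → sum (map (f x) xs)) xs)
handshake f f-sym f-irr [] = divides 0 refl
handshake {A} f f-sym f-irr (x ∷ xs) with handshake f f-sym f-irr xs
... | divides q e = divides (row + q) eq
  where
  row = sum (map (f x) xs)
  column : ∀ ys → sum (map (λ y → f y x) ys) ≡ sum (map (f x) ys)
  column []       = refl
  column (y ∷ ys) = cong₂ _+_ (f-sym y x) (column ys)
  double : ∀ a b → a + (a + b * 2) ≡ (a + b) * 2
  double a b rewrite ℕ.*-distribʳ-+ 2 a b | ℕ.*-comm a 2 | ℕ.+-identityʳ a | ℕ.+-assoc a a (b * 2) = refl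
  eq : f x x + row + sum (map (λ y → f y x + sum (map (f y) xs)) xs) ≡ (row + q) * 2
  eq rewrite f-irr x | sum-map-+ (λ y → f y x) (λ y → sum (map (f y) xs)) xs | column xs | e = double row q

all-or : ∀ {A : Set} {P : A → Set} {Q : Set} xs → (∀ {x} → x ∈ xs → Q ⊎ P x) → Q ⊎ All P xs
all-or []       f = inj₂ []
all-or (x ∷ xs) f with f (here refl) | all-or xs (f ∘ there)
... | inj₁ q | _       = inj₁ q
... | inj₂ _ | inj₁ q  = inj₁ q
... | inj₂ p | inj₂ ps = inj₂ (p ∷ ps)

-- The bounds R(3,3) ≤ 6 and R(3,4) ≤ 9

module Ramsey {n} (a : Adjacency n) (c : Fin n → Fin n → Bool) (c-sym : ∀ x y → c x y ≡ c y x) where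

  Clique : List (Fin n) → Set
  Clique = AllPairs (λ x y → x ≢ y × a x y ≡ true)

  M : Bool → Fin n → Fin n → Set
  M = Mono a c

  ramsey₂ : ∀ κ ys → Clique ys → (∃₂ λ y z → (y ∈ ys × z ∈ ys) × M κ y z) ⊎ AllPairs (M (not κ)) ys
  ramsey₂ κ []       []       = inj₂ []
  ramsey₂ κ (y ∷ ys) (h ∷ cl) with all-or ys row | ramsey₂ κ ys cl
    where
    row : ∀ {z} → z ∈ ys → (∃₂ λ y′ z → (y′ ∈ y ∷ ys × z ∈ y ∷ ys) × M κ y′ z) ⊎ M (not κ) y z
    row {z} i with c y z Bool.≟ κ | All.lookup h i
    ... | yes e | ne , e′ = inj₁ (y , z , (here refl , there i) , ne , e′ , e)
    ... | no ¬e | ne , e′ = inj₂ (ne , e′ , ¬-not ¬e)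
  ... | inj₁ found | _ = inj₁ found
  ... | inj₂ _ | inj₁ (y , z , (i , j) , e) = inj₁ (y , z , (there i , there j) , e)
  ... | inj₂ r | inj₂ rs = inj₂ (r ∷ rs)

  Inside : Bool → List (Fin n) → Set
  Inside κ ys = ∃₂ λ x y → ∃ λ z → (x ∈ ys × y ∈ ys × z ∈ ys) × Triangle (M κ) x y z

  nbrs : Bool → Fin n → List (Fin n) → List (Fin n)
  nbrs κ x = filter λ y → c x y Bool.≟ κ

  -- An edge of colour `κ` among the three neighbours closes a triangle with `x`; without one they
  -- form a triangle of the other colour.
  third : ∀ κ {x ys} → Clique (x ∷ ys) → 3 ≤ length (nbrs κ x ys) →
          Inside κ (x ∷ ys) ⊎ Inside (not κ) (x ∷ ys)
  third κ {x} {ys} (h ∷ cl) long with ramsey₂ κ (nbrs κ x ys) (AllPairs.filter⁺ _ cl)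
  ... | inj₁ (y , z , (i , j) , yz) =
    inj₁ (_ , _ , _ , (here refl , inside i , inside j) , joined i , joined j , yz)
    where
    inside : ∀ {z} → z ∈ nbrs κ x ys → z ∈ x ∷ ys
    inside = there ∘ proj₁ ∘ ∈-filter⁻ (λ y → c x y Bool.≟ κ)
    joined : ∀ {z} → z ∈ nbrs κ x ys → M κ x z
    joined i with i′ , k ← ∈-filter⁻ (λ y → c x y Bool.≟ κ) {xs = ys} i
      with ne , e ← All.lookup h i′ = ne , e , k
  ... | inj₂ cl′ = inj₂ (go (nbrs κ x ys) (there ∘ proj₁ ∘ ∈-filter⁻ (λ y → c x y Bool.≟ κ)) cl′ long)
    where
    go : ∀ zs → (∀ {z} → z ∈ zs → z ∈ x ∷ ys) → AllPairs (M (not κ)) zs → 3 ≤ length zs →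
         Inside (not κ) (x ∷ ys)
    go (p ∷ q ∷ r ∷ _) inside ((pq ∷ pr ∷ _) ∷ (qr ∷ _) ∷ _) _ =
      p , q , r , (inside (here refl) , inside (there (here refl)) , inside (there (there (here refl)))) ,
      pq , pr , qr
    go (_ ∷ []) _ _ (s≤s ())
    go (_ ∷ _ ∷ []) _ _ (s≤s (s≤s ()))

  -- Among at least five other vertices, three are joined to `x` in the same colour.
  ramsey₃₃ : ∀ ys → Clique ys → 6 ≤ length ys → Inside true ys ⊎ Inside false ys
  ramsey₃₃ (x ∷ ys) cl (s≤s long)
    with 3 ℕ.≤? length (nbrs true x ys) | 3 ℕ.≤? length (nbrs false x ys)
  ... | yes p | _     = third true cl p
  ... | _     | yes q = Sum.swap (third false cl q)
  ... | no ¬p | no ¬q = ⊥-elim (ℕ.<⇒≱ long (subst (_≤ 4) (length-filter-split (c x) ys)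
                          (ℕ.+-mono-≤ (ℕ.≤-pred (ℕ.≰⇒> ¬p)) (ℕ.≤-pred (ℕ.≰⇒> ¬q)))))

  -- The diagonal of `c` is unrestricted, so `x` has to be excluded explicitly from its own
  -- neighbours.
  differs : Bool → Fin n → Fin n → Bool
  differs κ x y = not (does (x ≟ y)) ∧ does (c x y Bool.≟ κ)

  differs⁻¹ : ∀ {κ x y} → differs κ x y ≡ true → x ≢ y × c x y ≡ κ
  differs⁻¹ {κ} {x} {y} e with x ≟ y | c x y Bool.≟ κ
  ... | no x≢y | yes k = x≢y , k
  ... | no _   | no _  = case e of λ ()
  ... | yes _  | _     = case e of λ ()

  -- Four red or six blue neighbours of a vertex force one of the two cliques. Otherwise every
  -- vertex has exactly three red neighbours, and the red degrees would sum to the odd number 27.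
  ramsey₃₄ : ∀ xs → Unique xs → (∀ {x y} → x ∈ xs → y ∈ xs → x ≢ y → a x y ≡ true) →
             length xs ≡ 9 → MonoK3 a c Red ⊎ MonoK4 a c Blue
  ramsey₃₄ xs unique adjacent nine with all-or xs local
    where
    around : Bool → Fin n → List (Fin n)
    around κ x = filter (λ y → differs κ x y Bool.≟ true) xs

    joined : ∀ {κ x} → x ∈ xs → ∀ {y} → y ∈ around κ x → M κ x y
    joined {κ} {x} x∈ i with i′ , e ← ∈-filter⁻ (λ y → differs κ x y Bool.≟ true) {xs = xs} i
      with ne , k ← differs⁻¹ {κ} e = ne , adjacent x∈ i′ ne , k

    clique : ∀ κ x → Clique (around κ x)
    clique κ x = AllPairs.filter⁺ _ (AllPairs.zipWith (λ (ne , f) → ne , f ne)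
                   (unique , allPairs-∈ xs adjacent))

    count : ∀ x ys → length (filter (λ y → differs true x y Bool.≟ true) ys)
                     + length (filter (λ y → differs false x y Bool.≟ true) ys)
                     + length (filter (x ≟_) ys) ≡ length ys
    count x []       = refl
    count x (y ∷ ys) with x ≟ y | c x y
    ... | yes _ | _     = trans (ℕ.+-suc _ _) (cong suc (count x ys))
    ... | no _  | true  = cong suc (count x ys)
    ... | no _  | false = trans (cong (_+ length (filter (x ≟_) ys)) (ℕ.+-suc _ _)) (cong suc (count x ys))

    atMostOnce : ∀ x {ys} → Unique ys → length (filter (x ≟_) ys) ≤ 1
    atMostOnce x {[]} [] = z≤n
    atMostOnce x {y ∷ ys} (h ∷ u) with x ≟ y
    ... | no _ = atMostOnce x u
    ... | yes refl = s≤s (ℕ.≤-reflexive (cong length (filter-none (x ≟_) h)))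

    local : ∀ {x} → x ∈ xs → (MonoK3 a c Red ⊎ MonoK4 a c Blue) ⊎ length (around true x) ≡ 3
    local {x} x∈ with 4 ℕ.≤? length (around true x) | 6 ℕ.≤? length (around false x)
    ... | yes p | _ with ramsey₂ true (around true x) (clique true x)
    ...   | inj₁ (y , z , (i , j) , yz) = inj₁ (inj₁ (monoK₃ (joined x∈ i , joined x∈ j , yz)))
    ...   | inj₂ blues = inj₁ (inj₂ (go blues p))
      where
      go : ∀ {zs} → AllPairs (M false) zs → 4 ≤ length zs → MonoK4 a c Blue
      go ((pq ∷ pr ∷ ps ∷ _) ∷ (qr ∷ qs ∷ _) ∷ (rs ∷ _) ∷ _) _ = monoK₄ pq pr ps (qr , qs , rs)
      go (_ ∷ []) (s≤s ())
      go (_ ∷ _ ∷ []) (s≤s (s≤s ()))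
      go (_ ∷ _ ∷ _ ∷ []) (s≤s (s≤s (s≤s ())))
    local {x} x∈ | no _ | yes q with ramsey₃₃ (around false x) (clique false x) q
    ... | inj₁ (_ , _ , _ , _ , t) = inj₁ (inj₁ (monoK₃ t))
    ... | inj₂ (_ , _ , _ , (i , j , k) , t) =
      inj₁ (inj₂ (monoK₄ (joined x∈ i) (joined x∈ j) (joined x∈ k) t))
    -- Of the nine vertices at most five are blue neighbours of `x` and at most one is `x` itself,
    -- which leaves at least three red ones.
    local {x} x∈ | no ¬p | no ¬q = inj₂ (ℕ.≤-antisym (ℕ.≤-pred (ℕ.≰⇒> ¬p)) (ℕ.+-cancelʳ-≤ 6 3 _
      (ℕ.≤-trans (ℕ.≤-reflexive (sym (trans (count x xs) nine)))
        (ℕ.≤-trans (ℕ.≤-reflexive (ℕ.+-assoc (length (around true x)) _ _))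
          (ℕ.+-monoʳ-≤ (length (around true x))
            (ℕ.+-mono-≤ (ℕ.≤-pred (ℕ.≰⇒> ¬q)) (atMostOnce x unique)))))))
  ... | inj₁ found = found
  ... | inj₂ cubic = ⊥-elim (toWitnessFalse {a? = 2 ∣? 27} _ (subst (2 ∣_) total (handshake f f-sym f-irr xs)))
    where
    f : Fin n → Fin n → ℕ
    f x y = if differs true x y then 1 else 0
    f-sym : ∀ x y → f x y ≡ f y x
    f-sym x y rewrite c-sym x y with x ≟ y | y ≟ x
    ... | yes _   | yes _   = refl
    ... | no _    | no _    = refl
    ... | yes x≡y | no y≢x  = ⊥-elim (y≢x (sym x≡y))
    ... | no x≢y  | yes y≡x = ⊥-elim (x≢y (sym y≡x))
    f-irr : ∀ x → f x x ≡ 0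
    f-irr x rewrite dec-true (x ≟ x) refl = refl
    total : sum (map (λ x → sum (map (f x) xs)) xs) ≡ 27
    total = trans (sum-const (λ x → sum (map (f x) xs)) 3
                    (All.map (λ {x} e → trans (sum-indicator (differs true x) xs) e) cubic))
                  (cong (_* 3) nine)

-- The join of K₇ with an independent set

-- Used for `k = 7` as the 8-colouring of the join: the independent part shares the last colour.
squash : ∀ k {n} → Fin n → Fin (suc k)
squash zero    _       = zero
squash (suc k) zero    = zero
squash (suc k) (suc x) = suc (squash k x)

squash-injective : ∀ k {n} {x y : Fin n} → (toℕ x ℕ.<ᵇ k) ≡ true → squash k x ≡ squash k y → x ≡ y
squash-injective zero    {x = zero}  () _
squash-injective zero    {x = suc x} () _
squash-injective (suc k) {x = zero}  {zero}  _ _ = refl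
squash-injective (suc k) {x = suc x} {suc y} l e =
  cong suc (squash-injective k l (suc-injective e))

module Sharp (m : ℕ) where

  low : Fin (9 + m) → Bool
  low x = toℕ x ℕ.<ᵇ 7

  join : Fin (9 + m) → Fin (9 + m) → Bool
  join x y = (low x ∨ low y) ∧ not (does (x ≟ y))

  join-low : ∀ {x y} → low x ≡ true ⊎ low y ≡ true → x ≢ y → join x y ≡ true
  join-low {x} {y} l x≢y rewrite dec-false (x ≟ y) x≢y = trans (∧-identityʳ _) (or l)
    where
    or : low x ≡ true ⊎ low y ≡ true → low x ∨ low y ≡ true
    or (inj₁ e) rewrite e = refl
    or (inj₂ e) rewrite e = ∨-zeroʳ (low x)

  join⁻¹ : ∀ {x y} → join x y ≡ true → (low x ≡ true ⊎ low y ≡ true) × x ≢ y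
  join⁻¹ {x} {y} e with low x | low y | x ≟ y
  ... | true  | _     | no x≢y = inj₁ refl , x≢y
  ... | false | true  | no x≢y = inj₂ refl , x≢y
  ... | true  | _     | yes _  = case e of λ ()
  ... | false | true  | yes _  = case e of λ ()
  ... | false | false | _      = case e of λ ()

  join-sym : ∀ x y → join x y ≡ join y x
  join-sym x y with x ≟ y | y ≟ x
  ... | yes _   | yes _   = cong (_∧ false) (∨-comm (low x) (low y))
  ... | no _    | no _    = cong (_∧ true) (∨-comm (low x) (low y))
  ... | yes x≡y | no y≢x  = ⊥-elim (y≢x (sym x≡y))
  ... | no x≢y  | yes y≡x = ⊥-elim (x≢y (sym y≡x))

  G : Graph (9 + m)
  G .adj = join
  G .Graph.sym = join-sym
  G .irrefl x rewrite dec-true (x ≟ x) refl = ∧-zeroʳ (low x ∨ low x)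

  ¬arrows : ¬ ArrowsK3K4 join
  ¬arrows = eightColourable⇒¬arrows (squash 7) λ e → proper (join⁻¹ e)
    where
    proper : ∀ {x y} → (low x ≡ true ⊎ low y ≡ true) × x ≢ y → squash 7 x ≢ squash 7 y
    proper (inj₁ l , x≢y) e = x≢y (squash-injective 7 l e)
    proper (inj₂ l , x≢y) e = x≢y (sym (squash-injective 7 l (sym e)))

  base : List (Fin (9 + m))
  base = 0F ∷ 1F ∷ 2F ∷ 3F ∷ 4F ∷ 5F ∷ 6F ∷ []

  base-low : All (λ x → low x ≡ true) base
  base-low = refl ∷ refl ∷ refl ∷ refl ∷ refl ∷ refl ∷ refl ∷ []

  -- Both ends of a non-edge lie outside K₇, so adding the edge completes a K₉ on `u`, `v` and
  -- `base`.
  saturated : ∀ u v → u ≢ v → join u v ≡ false → ArrowsK3K4 (addEdge join u v)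
  saturated u v u≢v uv c c-sym = Ramsey.ramsey₃₄ (addEdge join u v) c c-sym (u ∷ v ∷ base)
    ((u≢v ∷ high u (¬low ∘ inj₁)) ∷ high v (¬low ∘ inj₂) ∷ unique) adjacent refl
    where
    ¬low : ¬ (low u ≡ true ⊎ low v ≡ true)
    ¬low l = case trans (sym (join-low l u≢v)) uv of λ ()
    high : ∀ x → low x ≢ true → All (x ≢_) base
    high x ¬l = All.map (λ { l refl → ¬l l }) base-low
    unique : Unique base
    unique = toWitness {a? = AllPairs.allPairs? (λ x y → ¬? (x ≟ y)) base} _
    adjacent : ∀ {x y} → x ∈ u ∷ v ∷ base → y ∈ u ∷ v ∷ base → x ≢ y → addEdge join u v x y ≡ true
    adjacent {x} {y} (there (there i)) _ x≢y =
      addEdge-old {a = join} {u} {v} {x} {y} (join-low (inj₁ (All.lookup base-low i)) x≢y)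
    adjacent {x} {y} _ (there (there j)) x≢y =
      addEdge-old {a = join} {u} {v} {x} {y} (join-low (inj₂ (All.lookup base-low j)) x≢y)
    adjacent (here x≡u)         (there (here y≡v)) _ = addEdge-new {a = join} (inj₁ (x≡u , y≡v))
    adjacent (there (here x≡v)) (here y≡u)         _ = addEdge-new {a = join} (inj₂ (x≡v , y≡u))
    adjacent (here refl)         (here refl)         x≢y = ⊥-elim (x≢y refl)
    adjacent (there (here refl)) (there (here refl)) x≢y = ⊥-elim (x≢y refl)

  coCritical : CoCriticalK3K4 G
  coCritical = (7F , 8F , (λ ()) , refl) , ¬arrows , saturated

  degree₇ : degree G 7F ≡ 7
  -- The first nine terms evaluate to seven ones and two zeros; the terms of the other `m` vertices
  -- all vanish.
  degree₇ = cong (7 +_) (trans (sum-const (λ w → if join 7F w then 1 else 0) 0 {rest}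
                                  (All.tabulate⁺ {f = λ (i : Fin m) → 9 ↑ʳ i} λ _ → refl))
                               (ℕ.*-zeroʳ (length rest)))
    where
    rest : List (Fin (9 + m))
    rest = tabulate {n = m} (9 ↑ʳ_)

sharp : ∀ n → 9 ≤ n → Σ (Graph n) λ G → CoCriticalK3K4 G × MinDegree≡ G 7
sharp n large with m , refl ← ℕ.m≤n⇒∃[o]m+o≡n large =
  -- The lower bound just proved also supplies the degrees of all vertices of `G`; only one vertex
  -- of degree seven has to be exhibited.
  G , coCritical , minDegree≥7 n large G coCritical , 7F , degree₇
  where open Sharp m

theorem1p9 : (∀ (n : ℕ) → 9 ≤ n → (G : Graph n) → CoCriticalK3K4 G → MinDegree≥ G 7)
    × (∀ (n : ℕ) → 9 ≤ n → Σ (Graph n) λ G → CoCriticalK3K4 G × MinDegree≡ G 7)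
theorem1p9 = minDegree≥7 , sharp
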